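{- For each integer $k\ge 3$, each integer $d$ with $1\le d\le k-2$, every $0<\gamma<1/4$ and every $\epsilon>0$ there exists $n_0$ such that the following holds for all $n\ge n_0$. Suppose that $\mathcal{H}$ is a $k$-graph on $n$ vertices such that for all but at most $\epsilon \binom{n}{d}$ sets $S\in\binom{V(\mathcal{H})}{d}$, \[ \deg(S)\ge \left( \frac{k-d}{k} - \frac{1}{k^{k-d}}+\gamma \right) \binom{n-d}{k-d}. \] Then $\mathcal{H}$ contains a matching that covers all but at most $2 \epsilon^{1/k}n$ vertices.
   Context: A $k$-graph is a pair $(V,E)$ with $E\subseteq\binom{V}{k}$; $\deg(S)$ is the number of edges containing $S$. A matching is a set of pairwise disjoint edges.
   Formalization: The parameters γ and ε range over positive rational numbers rather than real numbers (for γ this loses nothing); the bound 2ε^{1/k}n on uncovered vertices is stated in the equivalent k-th power form. -}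

module Defs where

open import Data.Nat as ℕ using (ℕ; zero; suc; _∸_)
open import Data.Nat.Combinatorics using (_C_)
open import Data.Integer using (+_)
open import Data.Rational as ℚ using (ℚ; _/_; 0ℚ; 1ℚ)
open import Data.Bool using (Bool; true; false; _∧_)
open import Data.List using (List; []; _∷_; length; filter; map; _++_)
open import Data.List.Relation.Unary.All using (All)
open import Data.List.Relation.Unary.AllPairs using (AllPairs)
open import Data.Vec using (Vec; []; _∷_)
open import Data.Fin.Subset using (Subset; _⊆_; ∣_∣; _∩_; Empty; ⋃; inside; outside)
open import Data.Fin.Subset.Properties using (_⊆?_)
open import Relation.Nullary using (does; ¬?)
open import Relation.Binary.PropositionalEquality using (_≡_)

toℚ : ℕ → ℚ
toℚ n = + n / 1

-- a / b as a rational (only used with b ≠ 0; frac a 0 = 0 by convention)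
frac : ℕ → ℕ → ℚ
frac a zero    = 0ℚ
frac a (suc b) = + a / suc b

_^ℚ_ : ℚ → ℕ → ℚ
q ^ℚ zero  = 1ℚ
q ^ℚ suc m = q ℚ.* (q ^ℚ m)

allSubsets : (n : ℕ) → List (Subset n)
allSubsets zero    = [] ∷ []
allSubsets (suc n) = map (outside ∷_) (allSubsets n) ++ map (inside ∷_) (allSubsets n)

dSets : (n d : ℕ) → List (Subset n)
dSets n d = filter (λ S → ∣ S ∣ ℕ.≟ d) (allSubsets n)

record KGraph (n k : ℕ) : Set where
  field
    edge    : Subset n → Bool
    uniform : ∀ T → edge T ≡ true → ∣ T ∣ ≡ k
open KGraph public

deg : ∀ {n k} → KGraph n k → Subset n → ℕ
deg {n} H S = length (filter (λ T → Data.Bool._≟_ (edge H T ∧ does (S ⊆? T)) true) (allSubsets n))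

IsMatching : ∀ {n k} → KGraph n k → List (Subset n) → Set
IsMatching H M = All (λ e → edge H e ≡ true) M × AllPairs (λ e f → Empty (e ∩ f)) M
  where open import Data.Product using (_×_)

threshold : (n k d : ℕ) → ℚ → ℚ
threshold n k d γ =
  ((frac (k ∸ d) k ℚ.- frac 1 (k ℕ.^ (k ∸ d))) ℚ.+ γ) ℚ.* toℚ ((n ∸ d) C (k ∸ d))

badCount : ∀ {n k} → KGraph n k → (d : ℕ) → ℚ → ℕ
badCount {n} {k} H d γ =
  length (filter (λ S → ¬? (threshold n k d γ ℚ.≤? toℚ (deg H S))) (dSets n d))

-- Let r = k − d, and let M be a matching leaving a set U of more than
-- 2 ε^{1/k} n vertices uncovered.  Most d-sets in U satisfy the degree
-- condition.  Chop U into further blocks of size k, so that M together with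
-- these blocks partitions all but fewer than k vertices.  For a good d-tuple s
-- in U and an average r-tuple b of blocks, the set of x ∈ [k]^r for which s and
-- the vertices at positions x of b form an edge has more than r k^{r-1} − 1
-- elements.  By pigeonhole one set g ⊆ [k]^r with at least r k^{r-1} elements
-- occurs for a positive proportion of the pairs (s , b), and Erdős' argument for
-- complete multipartite subhypergraphs makes g occur on a large box of such
-- pairs.  So H contains a blow-up of g, and it remains to find a matching in it
-- with more edges than blocks met.  If some part of [k]^r has no vertex v all
-- of whose tuples lie in g, then using every x ∈ g once, on suitably chosen
-- copies of the blocks, meets only r k^{r-1} − 1 blocks.  Otherwise choose such
-- a vertex in each part; since k^r − (k−1)^r < r k^{r-1}, some tuple of g avoids
-- all of them, and it extends to r + 1 disjoint tuples of g.  Replacing the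
-- blocks met by the new edges enlarges M.

{-# OPTIONS --safe #-}
module Submission where

open import Defs
open import Data.Nat as ℕ using (ℕ; _≤_; _∸_)
open import Data.Nat.Combinatorics using (_C_)
open import Data.Rational as ℚ using (ℚ; 0ℚ)
open import Data.Product using (Σ; _×_; ∃)
open import Data.List using (List)
open import Data.Fin.Subset using (Subset; ∣_∣; ⋃)
open import Data.Nat using (zero; suc; pred; _+_; _*_; _^_; _<_; z≤n; s≤s; NonZero; >-nonZero; _⊔_; _!)
open import Data.Nat.Properties
open import Data.Nat.Combinatorics using (nCk+nC[k+1]≡[n+1]C[k+1]; k>n⇒nCk≡0; nCk≡nC[n∸k]; nCn≡1; nC1≡n)
open import Data.Nat.ListAction using (sum)
open import Data.Nat.Tactic.RingSolver using (solve-∀)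
open import Data.Integer as ℤ using (-[1+_])
import Data.Integer.Properties as ℤ
open import Data.Rational using (mkℚ; 1ℚ; toℚᵘ)
import Data.Rational.Properties as ℚ
open import Data.Rational.Unnormalised as ℚᵘ using (mkℚᵘ; *≡*; *≤*; _≃_)
import Data.Rational.Unnormalised.Properties as ℚᵘ
import Data.Rational.Solver as ℚ
open import Data.Bool as Bool using (true; _∧_)
open import Data.Unit using (⊤; tt)
open import Data.Empty using (⊥; ⊥-elim)
open import Data.Product using (∃-syntax; _,_; proj₁; proj₂)
open import Data.Sum using (_⊎_; inj₁; inj₂; [_,_]′)
open import Data.Fin as Fin using (Fin; zero; suc; toℕ; inject≤; punchIn; punchOut; combine; cast)
import Data.Fin.Properties as Fin
open import Data.Fin.Permutation.Components using (transpose; transpose-inverse)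
open import Data.Fin.Subset using (inside; outside; ⁅_⁆; _∪_; _∩_; _─_; ∁; Empty)
  renaming (_∈_ to _∈ˢ_; _∉_ to _∉ˢ_; _⊆_ to _⊆ˢ_; ⊥ to ∅)
open import Data.Fin.Subset.Properties
  using (_⊆?_; ∉⊥; x∈⁅x⁆; x∈⁅y⁆⇒x≡y; ∣⁅x⁆∣≡1; x∈p∪q⁺; x∈p∪q⁻; x∈p∩q⁻; ⊆-antisym; drop-∷-⊆;
         x∈p∧x∉q⇒x∈p─q; p─q⊆p; ∣∁p∣≡n∸∣p∣; ∪-assoc; ∪-identityˡ; x∈∁p⇒x∉p; x∉p⇒x∈∁p)
  renaming (_∈?_ to _∈ˢ?_)
open import Data.List as List
  using ([]; _∷_; length; filter; map; _++_; concatMap; cartesianProductWith; cartesianProduct; allFin; take)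
open import Data.List.Properties
  using (length-map; length-++; length-take; length-tabulate; map-tabulate; ++-assoc; concatMap-++)
open import Data.List.Membership.Propositional using (_∈_; _∉_)
open import Data.List.Membership.Propositional.Properties
open import Data.List.Relation.Unary.All as All using (All; []; _∷_)
open import Data.List.Relation.Unary.All.Properties using (all-filter; ¬All⇒Any¬; ++⁻ˡ; ++⁻ʳ)
open import Data.List.Relation.Unary.Any as Any using (Any; here; there)
open import Data.List.Relation.Unary.Any.Properties using (lookup-result)
open import Data.List.Relation.Unary.AllPairs as AllPairs using (AllPairs; []; _∷_)
open import Data.List.Relation.Unary.Unique.Propositional using (Unique)
import Data.List.Relation.Unary.Unique.Propositional.Properties as Unique
open import Data.List.Relation.Binary.Disjoint.Propositional using (Disjoint)
open import Data.List.Relation.Binary.Sublist.Propositional using (⊆-trans)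
  renaming (_⊆_ to _⊑_; _∷_ to _⊑∷_; _∷ʳ_ to _⊑∷ʳ_; [] to ⊑[]; lookup to ⊑-lookup)
open import Data.List.Relation.Binary.Sublist.Propositional.Properties using (filter-⊆; take-⊆; All-resp-⊆)
open import Data.Vec as Vec using (Vec; []; _∷_; lookup; removeAt; insertAt; tabulate; zipWith)
open import Data.Vec.Properties
  using (insertAt-removeAt; lookup∘tabulate; tabulate∘lookup; tabulate-cong; lookup-zipWith; ∷-injective;
         length-toList; toList-++)
import Data.Vec.Properties as Vec
open import Function using (_∘_; id)
open import Relation.Nullary using (¬_; Dec; yes; no; does; contradiction; ¬?; _→-dec_; _×-dec_)
open import Relation.Nullary.Decidable using (dec-true; dec-false; decidable-stable)
open import Relation.Unary using (Decidable)
open import Relation.Binary.Definitions using (DecidableEquality)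
open import Relation.Binary.PropositionalEquality
  using (_≡_; _≢_; refl; sym; trans; cong; cong₂; subst; subst₂; module ≡-Reasoning)

-- The constant in the degree condition is tuned to the pigeonhole step: multiplied by k^r it reads
-- r k^(r-1) - 1 + γ k^r, so the average exceeds r k^(r-1) - 1 by a fixed amount, and by integrality
-- sets with at least r k^(r-1) elements carry positive weight. The auxiliary blocks are there
-- because the degree condition counts r-sets in the whole vertex set: without them, tuples meeting
-- U could hold most of the edges. They cost nothing, since only the blocks of M that are met have
-- to be given up. But they overlap the reservoir U of the d-tuples, so the d vertices are fixed
-- first, for a dense family of block tuples at once, and the blocks are then chosen away from them.
-- The factor 2 in 2 ε^(1/k) enters as 2^k ≥ 8: U spans so many d-tuples that at most one eighth are
-- bad. Everything is counted over ordered tuples with repetition, where sums factor over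
-- coordinates and over blocks. Estimates are cleared of denominators, with γ bounded below by 1/q
-- and ε = a/b.

private variable
  A B G : Set
  m n : ℕ

-- Finite sums over lists

∑ : List A → (A → ℕ) → ℕ
∑ xs f = sum (map f xs)

syntax ∑ xs (λ x → e) = ∑[ x ∈ xs ] e

⟦_⟧ : Dec A → ℕ
⟦ yes _ ⟧ = 1
⟦ no  _ ⟧ = 0

⟦⟧≤1 : (d : Dec A) → ⟦ d ⟧ ≤ 1
⟦⟧≤1 (yes _) = ≤-refl
⟦⟧≤1 (no  _) = z≤n

⟦⟧≡1 : (d : Dec A) → A → ⟦ d ⟧ ≡ 1
⟦⟧≡1 (yes _) _ = refl
⟦⟧≡1 (no ¬a) a = contradiction a ¬a

⟦⟧>0 : (d : Dec A) → 0 < ⟦ d ⟧ → A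
⟦⟧>0 (yes a) _ = a

⟦⟧-mono : (d : Dec A) (e : Dec B) → (A → B) → ⟦ d ⟧ ≤ ⟦ e ⟧
⟦⟧-mono (yes a) e f = ≤-reflexive (sym (⟦⟧≡1 e (f a)))
⟦⟧-mono (no  _) e f = z≤n

⟦⟧*≤ : (d : Dec A) {x y : ℕ} → (A → x ≤ y) → ⟦ d ⟧ * x ≤ y
⟦⟧*≤ (yes a) {x} f = ≤-trans (≤-reflexive (+-identityʳ x)) (f a)
⟦⟧*≤ (no  _) f = z≤n

*⟦⟧≤ : (d : Dec A) {x y : ℕ} → (A → x ≤ y) → x * ⟦ d ⟧ ≤ y
*⟦⟧≤ d {x} f = ≤-trans (≤-reflexive (*-comm x ⟦ d ⟧)) (⟦⟧*≤ d f)

∑-mono : (xs : List A) {f g : A → ℕ} → (∀ {x} → x ∈ xs → f x ≤ g x) → ∑ xs f ≤ ∑ xs g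
∑-mono []       h = z≤n
∑-mono (x ∷ xs) h = +-mono-≤ (h (here refl)) (∑-mono xs (h ∘ there))

∑-cong : (xs : List A) {f g : A → ℕ} → (∀ x → f x ≡ g x) → ∑ xs f ≡ ∑ xs g
∑-cong []       h = refl
∑-cong (x ∷ xs) h = cong₂ _+_ (h x) (∑-cong xs h)

∑-++ : (xs ys : List A) (f : A → ℕ) → ∑ (xs ++ ys) f ≡ ∑ xs f + ∑ ys f
∑-++ []       ys f = refl
∑-++ (x ∷ xs) ys f = trans (cong (f x +_) (∑-++ xs ys f)) (sym (+-assoc (f x) _ _))

∑-map : (g : B → A) (xs : List B) (f : A → ℕ) → ∑ (map g xs) f ≡ ∑ xs (f ∘ g)
∑-map g []       f = refl
∑-map g (x ∷ xs) f = cong (f (g x) +_) (∑-map g xs f)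

∑-*ˡ : (c : ℕ) (xs : List A) (f : A → ℕ) → ∑ xs (λ x → c * f x) ≡ c * ∑ xs f
∑-*ˡ c []       f = sym (*-zeroʳ c)
∑-*ˡ c (x ∷ xs) f = trans (cong (c * f x +_) (∑-*ˡ c xs f)) (sym (*-distribˡ-+ c (f x) _))

∑-+ : (xs : List A) (f g : A → ℕ) → ∑ xs (λ x → f x + g x) ≡ ∑ xs f + ∑ xs g
∑-+ []       f g = refl
∑-+ (x ∷ xs) f g = trans (cong (f x + g x +_) (∑-+ xs f g)) (interchange (f x) (g x) _ _)
  where
  interchange : ∀ a b c d → a + b + (c + d) ≡ a + c + (b + d)
  interchange = solve-∀

∑-const : (xs : List A) (c : ℕ) → ∑ xs (λ _ → c) ≡ length xs * c
∑-const []       c = refl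
∑-const (x ∷ xs) c = cong (c +_) (∑-const xs c)

length≡∑ : (xs : List A) → length xs ≡ ∑ xs (λ _ → 1)
length≡∑ xs = sym (trans (∑-const xs 1) (*-identityʳ _))

∑-bound : (xs : List A) {f : A → ℕ} {c : ℕ} → (∀ {x} → x ∈ xs → f x ≤ c) → ∑ xs f ≤ length xs * c
∑-bound xs h = ≤-trans (∑-mono xs h) (≤-reflexive (∑-const xs _))

∑-bound′ : (xs : List A) {f : A → ℕ} {c : ℕ} → (∀ {x} → x ∈ xs → c ≤ f x) → length xs * c ≤ ∑ xs f
∑-bound′ xs h = ≤-trans (≤-reflexive (sym (∑-const xs _))) (∑-mono xs h)

∑-swap : (xs : List A) (ys : List B) (f : A → B → ℕ) →
         ∑[ x ∈ xs ] ∑[ y ∈ ys ] f x y ≡ ∑[ y ∈ ys ] ∑[ x ∈ xs ] f x y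
∑-swap []       ys f = sym (trans (∑-const ys 0) (*-zeroʳ (length ys)))
∑-swap (x ∷ xs) ys f = trans (cong (∑ ys (f x) +_) (∑-swap xs ys f)) (sym (∑-+ ys (f x) _))

∑-cartesianProductWith : (g : A → B → G) (xs : List A) (ys : List B) (f : G → ℕ) →
  ∑ (cartesianProductWith g xs ys) f ≡ ∑[ x ∈ xs ] ∑[ y ∈ ys ] f (g x y)
∑-cartesianProductWith g []       ys f = refl
∑-cartesianProductWith g (x ∷ xs) ys f =
  trans (∑-++ (map (g x) ys) _ f)
        (cong₂ _+_ (∑-map (g x) ys f) (∑-cartesianProductWith g xs ys f))

∑-concatMap : (g : B → List A) (xs : List B) (f : A → ℕ) →
  ∑ (concatMap g xs) f ≡ ∑[ x ∈ xs ] ∑ (g x) f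
∑-concatMap g []       f = refl
∑-concatMap g (x ∷ xs) f = trans (∑-++ (g x) _ f) (cong (∑ (g x) f +_) (∑-concatMap g xs f))

length-cartesianProductWith : (g : A → B → G) (xs : List A) (ys : List B) →
  length (cartesianProductWith g xs ys) ≡ length xs * length ys
length-cartesianProductWith g xs ys = begin
  length (cartesianProductWith g xs ys)   ≡⟨ length≡∑ (cartesianProductWith g xs ys) ⟩
  ∑ (cartesianProductWith g xs ys) (λ _ → 1) ≡⟨ ∑-cartesianProductWith g xs ys _ ⟩
  ∑[ x ∈ xs ] ∑ ys (λ _ → 1)              ≡⟨ ∑-const xs _ ⟩
  length xs * ∑ ys (λ _ → 1)              ≡⟨ cong (length xs *_) (length≡∑ ys) ⟨
  length xs * length ys                   ∎
  where open ≡-Reasoning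

length-filter≡∑ : {P : A → Set} (P? : Decidable P) (xs : List A) → length (filter P? xs) ≡ ∑[ x ∈ xs ] ⟦ P? x ⟧
length-filter≡∑ P? []       = refl
length-filter≡∑ P? (x ∷ xs) with P? x
... | yes _ = cong suc (length-filter≡∑ P? xs)
... | no  _ = length-filter≡∑ P? xs

∑-filter : {P : A → Set} (P? : Decidable P) (xs : List A) (f : A → ℕ) → ∑ (filter P? xs) f ≤ ∑ xs f
∑-filter P? []       f = z≤n
∑-filter P? (x ∷ xs) f with P? x
... | yes _ = +-monoʳ-≤ (f x) (∑-filter P? xs f)
... | no  _ = ≤-trans (∑-filter P? xs f) (m≤n+m _ (f x))

-- Removal without decidable equality: every entry other than `x` survives in `zs`, so `∑-inclusion`
-- can recurse along a duplicate-free list.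
∑-remove : {x : A} {ys : List A} → x ∈ ys →
  Σ (List A) λ zs → (∀ f → ∑ ys f ≡ f x + ∑ zs f) × (∀ {y} → y ∈ ys → y ≢ x → y ∈ zs)
∑-remove {ys = y ∷ ys} (here refl) = ys , (λ _ → refl) , λ
  { (here refl) y≢x → contradiction refl y≢x
  ; (there p)   _   → p }
∑-remove {x = x} {y ∷ ys} (there p) with ∑-remove p
... | zs , eq , sub = y ∷ zs , (λ f → trans (cong (f y +_) (eq f)) (shuffle (f y) (f x) (∑ zs f))) , λ
  { (here refl) _ → here refl
  ; (there q)   y≢x → there (sub q y≢x) }
  where
  shuffle : ∀ a b c → a + (b + c) ≡ b + (a + c)
  shuffle = solve-∀

∑-inclusion : {xs ys : List A} → Unique xs → (∀ {x} → x ∈ xs → x ∈ ys) → (f : A → ℕ) → ∑ xs f ≤ ∑ ys f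
∑-inclusion []         sub f = z≤n
∑-inclusion (px ∷ pxs) sub f with ∑-remove (sub (here refl))
... | zs , eq , rest = ≤-trans (+-monoʳ-≤ (f _) (∑-inclusion pxs sub′ f)) (≤-reflexive (sym (eq f)))
  where
  sub′ : ∀ {y} → y ∈ _ → y ∈ zs
  sub′ q = rest (sub (there q)) (λ { refl → All.lookup px q refl })

∑-member : {x : A} {xs : List A} → x ∈ xs → (f : A → ℕ) → f x ≤ ∑ xs f
∑-member {xs = y ∷ ys} (here refl) f = m≤m+n (f y) _
∑-member {xs = y ∷ ys} (there p)   f = ≤-trans (∑-member p f) (m≤n+m _ (f y))

length≤-inclusion : {xs ys : List A} → Unique xs → (∀ {x} → x ∈ xs → x ∈ ys) → length xs ≤ length ys
length≤-inclusion {xs = xs} {ys} u sub =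
  subst₂ _≤_ (sym (length≡∑ xs)) (sym (length≡∑ ys))
    (∑-inclusion u sub (λ _ → 1))

∑-exclusive : {R : A → Set} (R? : ∀ x → Dec (R x)) {xs : List A} →
  AllPairs (λ x y → R x → R y → ⊥) xs → ∑[ x ∈ xs ] ⟦ R? x ⟧ ≤ 1
∑-exclusive R? [] = z≤n
∑-exclusive R? {x ∷ xs} (px ∷ pxs) with R? x
... | no _  = ∑-exclusive R? pxs
... | yes r = s≤s (≤-trans (∑-bound xs none) (≤-reflexive (*-zeroʳ (length xs))))
  where
  none : ∀ {y} → y ∈ xs → ⟦ R? y ⟧ ≤ 0
  none {y} y∈xs with R? y
  ... | yes s = ⊥-elim (All.lookup px y∈xs r s)
  ... | no  _ = z≤n

∑-argmax : (xs : List A) (f : A → ℕ) → 0 < ∑ xs f → ∃[ x ] x ∈ xs × ∑ xs f ≤ length xs * f x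
∑-argmax (x ∷ xs) f pos with 1 ≤? ∑ xs f
... | no ≡0 = x , here refl , +-monoʳ-≤ (f x) (≤-trans (≤-pred (≰⇒> ≡0)) z≤n)
... | yes pos′ with ∑-argmax xs f pos′
... | y , y∈xs , le with f x ≤? f y
... | yes fx≤fy = y , there y∈xs , +-mono-≤ fx≤fy le
... | no  fx≰fy = x , here refl , +-monoʳ-≤ (f x) (≤-trans le (*-monoʳ-≤ (length xs) (<⇒≤ (≰⇒> fx≰fy))))

-- Each `u` spoils at most one entry of `xs`, by exclusivity, so double counting bounds the spoiled
-- entries by `length us`. It serves for finding objects off a forbidden set, for fresh entries of a
-- tuple, and for the edges kept in an exchange.
avoid : {U : Set} {R : A → U → Set} (R? : ∀ x u → Dec (R x u)) (xs : List A) (us : List U) →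
  (∀ u → AllPairs (λ x y → R x u → R y u → ⊥) xs) →
  length xs ≤ length (filter (λ x → ¬? (Any.any? (R? x) us)) xs) + length us
avoid {R = R} R? xs us excl = begin
  length xs                                   ≡⟨ length≡∑ xs ⟩
  ∑[ x ∈ xs ] 1                               ≤⟨ ∑-mono xs (λ {x} _ → split x) ⟩
  ∑[ x ∈ xs ] (kept x + ∑[ u ∈ us ] ⟦ R? x u ⟧) ≡⟨ ∑-+ xs kept _ ⟩
  ∑ xs kept + ∑[ x ∈ xs ] ∑[ u ∈ us ] ⟦ R? x u ⟧ ≡⟨ cong₂ _+_ (sym (length-filter≡∑ _ xs)) (∑-swap xs us _) ⟩
  L + ∑[ u ∈ us ] ∑[ x ∈ xs ] ⟦ R? x u ⟧      ≤⟨ +-monoʳ-≤ L (∑-bound us (λ {u} _ → ∑-exclusive (λ x → R? x u) (excl u))) ⟩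
  L + length us * 1                           ≡⟨ cong (L +_) (*-identityʳ _) ⟩
  L + length us                               ∎
  where
  open ≤-Reasoning
  kept : _ → ℕ
  kept x = ⟦ ¬? (Any.any? (R? x) us) ⟧
  L = length (filter (λ x → ¬? (Any.any? (R? x) us)) xs)
  hit : ∀ x {us} → Any (R x) us → 1 ≤ ∑[ u ∈ us ] ⟦ R? x u ⟧
  hit x {u ∷ us} (here r)  = ≤-trans (≤-reflexive (sym (⟦⟧≡1 (R? x u) r))) (m≤m+n _ _)
  hit x {u ∷ us} (there p) = ≤-trans (hit x p) (m≤n+m _ ⟦ R? x u ⟧)
  split : ∀ x → 1 ≤ kept x + ∑[ u ∈ us ] ⟦ R? x u ⟧
  split x with Any.any? (R? x) us
  ... | yes p = hit x p
  ... | no  _ = s≤s z≤n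

-- Tuples and sublists

tuples : List A → (m : ℕ) → List (Vec A m)
tuples xs zero    = [] ∷ []
tuples xs (suc m) = cartesianProductWith _∷_ xs (tuples xs m)

∑-tuples : (xs : List A) (f : Vec A (suc m) → ℕ) →
  ∑ (tuples xs (suc m)) f ≡ ∑[ x ∈ xs ] ∑[ v ∈ tuples xs m ] f (x ∷ v)
∑-tuples {m = m} xs f = ∑-cartesianProductWith _∷_ xs (tuples xs m) f

length-tuples : (xs : List A) (m : ℕ) → length (tuples xs m) ≡ length xs ^ m
length-tuples xs zero    = refl
length-tuples xs (suc m) =
  trans (length-cartesianProductWith _∷_ xs (tuples xs m)) (cong (length xs *_) (length-tuples xs m))

∈-tuples : {xs : List A} (v : Vec A m) → (∀ i → Vec.lookup v i ∈ xs) → v ∈ tuples xs m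
∈-tuples []      h = here refl
∈-tuples (x ∷ v) h = ∈-cartesianProductWith⁺ _∷_ (h Fin.zero) (∈-tuples v (h ∘ Fin.suc))
  where import Data.Fin as Fin

tuples-⊆ : {xs ys : List A} → Unique xs → (∀ {x} → x ∈ xs → x ∈ ys) →
  (f : Vec A m → ℕ) → ∑ (tuples xs m) f ≤ ∑ (tuples ys m) f
tuples-⊆ {m = zero}  u sub f = ≤-refl
tuples-⊆ {m = suc m} {xs} {ys} u sub f = begin
  ∑ (tuples xs (suc m)) f                    ≡⟨ ∑-tuples xs f ⟩
  ∑[ x ∈ xs ] ∑[ v ∈ tuples xs m ] f (x ∷ v) ≤⟨ ∑-mono xs (λ {x} _ → tuples-⊆ u sub (λ v → f (x ∷ v))) ⟩
  ∑[ x ∈ xs ] ∑[ v ∈ tuples ys m ] f (x ∷ v) ≤⟨ ∑-inclusion u sub _ ⟩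
  ∑[ x ∈ ys ] ∑[ v ∈ tuples ys m ] f (x ∷ v) ≡⟨ ∑-tuples ys f ⟨
  ∑ (tuples ys (suc m)) f                    ∎
  where open ≤-Reasoning

sublists : List A → List (List A)
sublists []       = [] ∷ []
sublists (x ∷ xs) = sublists xs ++ map (x ∷_) (sublists xs)

length-sublists : (xs : List A) → length (sublists xs) ≡ 2 ^ length xs
length-sublists []       = refl
length-sublists (x ∷ xs) = begin
  length (sublists xs ++ map (x ∷_) (sublists xs))        ≡⟨ length-++ (sublists xs) ⟩
  length (sublists xs) + length (map (x ∷_) (sublists xs)) ≡⟨ cong (length (sublists xs) +_) (length-map (x ∷_) (sublists xs)) ⟩
  length (sublists xs) + length (sublists xs)             ≡⟨ cong₂ _+_ (length-sublists xs) (trans (length-sublists xs) (sym (+-identityʳ _))) ⟩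
  2 ^ length (x ∷ xs)                                     ∎
  where open ≡-Reasoning

∈-sublists⇒⊑ : (xs : List A) {g : List A} → g ∈ sublists xs → g ⊑ xs
∈-sublists⇒⊑ []       (here refl) = ⊑[]
∈-sublists⇒⊑ (x ∷ xs) p with ∈-++⁻ (sublists xs) p
... | inj₁ q = x ⊑∷ʳ ∈-sublists⇒⊑ xs q
... | inj₂ q with ∈-map⁻ (x ∷_) q
... | _ , r , refl = refl ⊑∷ ∈-sublists⇒⊑ xs r

filter∈sublists : {P : A → Set} (P? : Decidable P) (xs : List A) → filter P? xs ∈ sublists xs
filter∈sublists P? []       = here refl
filter∈sublists P? (x ∷ xs) with P? x
... | yes _ = ∈-++⁺ʳ (sublists xs) (∈-map⁺ (x ∷_) (filter∈sublists P? xs))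
... | no  _ = ∈-++⁺ˡ (filter∈sublists P? xs)

-- Averaging shows that many y have more than t′ related h; pigeonhole over the
-- finitely many sublists of hs then makes these h the same for many y.
common-sublist : {R : A → B → Set} (R? : ∀ x y → Dec (R x y)) (t′ c : ℕ) (hs : List A) (ys : List B) →
  0 < length ys →
  (c * t′ + 1) * length ys ≤ c * ∑[ y ∈ ys ] ∑[ h ∈ hs ] ⟦ R? h y ⟧ →
  Σ (List A) λ g → g ⊑ hs × t′ < length g ×
    length ys ≤ c * length hs * 2 ^ length hs * ∑[ y ∈ ys ] ⟦ All.all? (λ h → R? h y) g ⟧
common-sublist {A = A} {B} {R} R? t′ c hs ys ys>0 dense = result
  where
  open ≤-Reasoning
  Q = length hs
  count : B → ℕ
  count y = ∑[ h ∈ hs ] ⟦ R? h y ⟧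
  w : List A → B → ℕ
  w g y = ⟦ t′ <? length g ⟧ * ⟦ All.all? (λ h → R? h y) g ⟧
  X : List A → ℕ
  X g = ⟦ t′ <? length g ⟧ * ∑[ y ∈ ys ] ⟦ All.all? (λ h → R? h y) g ⟧
  -- If more than `t′` entries are related to `y`, they form a sublist that `w` counts with weight
  -- 1, and the factor `Q` then bounds the whole count.
  count≤ : ∀ y → count y ≤ t′ + Q * ∑[ g ∈ sublists hs ] w g y
  count≤ y with t′ <? count y
  ... | no ≤t′ = ≤-trans (≮⇒≥ ≤t′) (m≤m+n t′ _)
  ... | yes t′<  = begin
    count y        ≤⟨ ∑-bound hs (λ {h} _ → ⟦⟧≤1 (R? h y)) ⟩
    Q * 1          ≤⟨ *-monoʳ-≤ Q (begin
      1              ≡⟨ sym (cong₂ _*_ (⟦⟧≡1 (t′ <? length g) long) (⟦⟧≡1 (All.all? (λ h → R? h y) g) (all-filter _ hs))) ⟩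
      w g y          ≤⟨ ∑-member (filter∈sublists _ hs) (λ g → w g y) ⟩
      ∑[ g ∈ sublists hs ] w g y ∎) ⟩
    Q * ∑[ g ∈ sublists hs ] w g y ≤⟨ m≤n+m _ t′ ⟩
    t′ + Q * ∑[ g ∈ sublists hs ] w g y ∎
    where
    g = filter (λ h → R? h y) hs
    long : t′ < length g
    long = subst (t′ <_) (sym (length-filter≡∑ (λ h → R? h y) hs)) t′<
  S = ∑ (sublists hs) X
  S≡ : ∑[ y ∈ ys ] ∑[ g ∈ sublists hs ] w g y ≡ S
  S≡ = trans (∑-swap ys (sublists hs) (λ y g → w g y))
             (∑-cong (sublists hs) (λ g → ∑-*ˡ ⟦ t′ <? length g ⟧ ys _))
  -- The density hypothesis exceeds the contribution `c * t′ * length ys` by one full `length ys`,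
  -- which only the long sublists can carry.
  many : length ys ≤ c * Q * S
  many = +-cancelˡ-≤ (c * t′ * length ys) _ _ (begin
    c * t′ * length ys + length ys             ≡⟨ lhs≡ (c * t′) (length ys) ⟩
    (c * t′ + 1) * length ys                   ≤⟨ dense ⟩
    c * ∑[ y ∈ ys ] count y                    ≤⟨ *-monoʳ-≤ c (∑-mono ys (λ {y} _ → count≤ y)) ⟩
    c * ∑[ y ∈ ys ] (t′ + Q * ∑[ g ∈ sublists hs ] w g y)
      ≡⟨ cong (c *_) (trans (∑-+ ys _ _) (cong₂ _+_ (∑-const ys t′) (trans (∑-*ˡ Q ys _) (cong (Q *_) S≡)))) ⟩
    c * (length ys * t′ + Q * S)               ≡⟨ rhs≡ c (length ys) t′ Q S ⟩
    c * t′ * length ys + c * Q * S             ∎)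
    where
    lhs≡ : ∀ a b → a * b + b ≡ (a + 1) * b
    lhs≡ = solve-∀
    rhs≡ : ∀ c y t q s → c * (y * t + q * s) ≡ c * t * y + c * q * s
    rhs≡ = solve-∀
  pos*ʳ : ∀ a b → 0 < a * b → 0 < b
  pos*ʳ a zero    p = contradiction (subst (0 <_) (*-zeroʳ a) p) (λ ())
  pos*ʳ a (suc b) p = s≤s z≤n
  pos*ˡ : ∀ a b → 0 < a * b → 0 < a
  pos*ˡ (suc a) b p = s≤s z≤n
  S>0 : 0 < S
  S>0 = pos*ʳ (c * Q) S (≤-trans ys>0 many)
  result : Σ (List A) λ g → g ⊑ hs × t′ < length g ×
    length ys ≤ c * length hs * 2 ^ length hs * ∑[ y ∈ ys ] ⟦ All.all? (λ h → R? h y) g ⟧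
  result with ∑-argmax (sublists hs) X S>0
  ... | g , g∈ , S≤ = g , ∈-sublists⇒⊑ hs g∈ ,
    ⟦⟧>0 (t′ <? length g) (pos*ˡ _ _ (pos*ʳ (length (sublists hs)) (X g) (≤-trans S>0 S≤))) , (begin
      length ys              ≤⟨ many ⟩
      c * Q * S              ≤⟨ *-monoʳ-≤ (c * Q) S≤ ⟩
      c * Q * (length (sublists hs) * X g) ≡⟨ cong (λ z → c * Q * (z * X g)) (length-sublists hs) ⟩
      c * Q * (2 ^ Q * X g)  ≡⟨ sym (*-assoc (c * Q) (2 ^ Q) (X g)) ⟩
      c * Q * 2 ^ Q * X g    ≤⟨ *-monoʳ-≤ (c * Q * 2 ^ Q) (⟦⟧*≤ (t′ <? length g) (λ _ → ≤-refl)) ⟩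
      c * Q * 2 ^ Q * ∑[ y ∈ ys ] ⟦ All.all? (λ h → R? h y) g ⟧ ∎)

-- Boxes in dense relations

*-pos : 0 < m → 0 < n → 0 < m * n
*-pos (s≤s _) (s≤s _) = s≤s z≤n

AllPairs-resp-⊑ : {R : A → A → Set} {xs ys : List A} → xs ⊑ ys → AllPairs R ys → AllPairs R xs
AllPairs-resp-⊑ ⊑[]          []         = []
AllPairs-resp-⊑ (y ⊑∷ʳ s)    (_ ∷ ps)   = AllPairs-resp-⊑ s ps
AllPairs-resp-⊑ (refl ⊑∷ s)  (px ∷ ps)  = All-resp-⊆ s px ∷ AllPairs-resp-⊑ s ps

AllPairs-members : {R : A → A → Set} {xs : List A} → (∀ {x y} → R x y → R y x) →
  AllPairs R xs → ∀ {x y} → x ∈ xs → y ∈ xs → x ≢ y → R x y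
AllPairs-members s (px ∷ ps) (here refl) (here refl) x≢y = contradiction refl x≢y
AllPairs-members s (px ∷ ps) (here refl) (there q)   _   = All.lookup px q
AllPairs-members s (px ∷ ps) (there p)   (here refl) _   = s (All.lookup px p)
AllPairs-members s (px ∷ ps) (there p)   (there q)   x≢y = AllPairs-members s ps p q x≢y

AllPairs-lookup : {R : A → A → Set} {xs : List A} → (∀ {x y} → R x y → R y x) →
  AllPairs R xs → ∀ i j → i ≢ j → R (List.lookup xs i) (List.lookup xs j)
AllPairs-lookup s (px ∷ ps) zero    zero    i≢j = contradiction refl i≢j
AllPairs-lookup s (px ∷ ps) zero    (suc j) _   = All.lookup px (∈-lookup j)
AllPairs-lookup s (px ∷ ps) (suc i) zero    _   = s (All.lookup px (∈-lookup i))
AllPairs-lookup s (px ∷ ps) (suc i) (suc j) i≢j = AllPairs-lookup s ps i j (i≢j ∘ cong suc)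

-- The number of entries of relative weight at least `1 / (2 * D)` that forces an average above
-- `t′`: it is `c * t′ + 1` for `c = 2 * D` in `common-sublist`.
poolSource : ℕ → ℕ → ℕ
poolSource t′ D = 2 * D * t′ + 1

-- The loss in `common-sublist` for `c = 2 * D` and a list of `poolSource t′ D` candidates.
stepDensity : ℕ → ℕ → ℕ
stepDensity t′ D = 2 * D * poolSource t′ D * 2 ^ poolSource t′ D

boxDensity : ℕ → ℕ → ℕ → ℕ
boxDensity t′ zero    D = D
boxDensity t′ (suc m) D = boxDensity t′ m (stepDensity t′ D)

-- A `1 / (2 * D)` part of the list is heavy and must still contain `poolSource` entries after `f`
-- forbidden vertices are avoided. Each coordinate forbids at most `suc t′ * w` further vertices to
-- the later ones.
boxSize : ℕ → ℕ → ℕ → ℕ → ℕ → ℕ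
boxSize t′ w zero    D f = 0
boxSize t′ w (suc m) D f = 2 * D * (poolSource t′ D + f) ⊔ boxSize t′ w m (stepDensity t′ D) (f + suc t′ * w)

stepDensity>0 : ∀ t′ D → 0 < D → 0 < stepDensity t′ D
stepDensity>0 t′ D D>0 = *-pos (*-pos (*-pos {2} (s≤s z≤n) D>0)
  (subst (0 <_) (+-comm 1 (2 * D * t′)) (s≤s z≤n))) (m^n>0 2 (poolSource t′ D))

-- Coordinates range over objects carrying vertices, because the argument runs twice: over single
-- vertices of the uncovered set and over blocks of `k` vertices.
module Boxes {V A : Set} (_≟_ : DecidableEquality V) (verts : A → List V) where

  open import Data.List.Membership.DecPropositional _≟_ using (_∈?_)

  _#_ : A → A → Set
  x # y = Disjoint (verts x) (verts y)

  #-sym : ∀ {x y} → x # y → y # x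
  #-sym d (p , q) = d (q , p)

  share⇒≡ : DecidableEquality A → {xs : List A} → AllPairs _#_ xs → ∀ {x y v} → x ∈ xs → y ∈ xs → v ∈ verts x → v ∈ verts y → x ≡ y
  share⇒≡ _≟ᴬ_ sep {x} {y} p q v∈x v∈y with x ≟ᴬ y
  ... | yes e = e
  ... | no ne = ⊥-elim (AllPairs-members (λ {x} {y} → #-sym {x} {y}) sep p q ne (v∈x , v∈y))

  -- A box with `t` objects in each of `m` coordinates. The parameter `y` stays free: `Q` selects
  -- parameters for which the whole box lies in `P`, and `many` keeps them dense, so that a further
  -- box can be extracted from `Q` itself.
  record Pools (t m : ℕ) (xs : List A) (F : List V) (D : ℕ) (ys : List B) (P : Vec A m → B → Set) : Set₁ where
    field
      pool      : Fin m → Fin t → A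
      pool∈     : ∀ j i → pool j i ∈ xs
      avoids    : ∀ j i → Disjoint (verts (pool j i)) F
      separated : ∀ j i j′ i′ {v} → v ∈ verts (pool j i) → v ∈ verts (pool j′ i′) → j ≡ j′ × i ≡ i′
      Q         : B → Set
      Q?        : ∀ y → Dec (Q y)
      Q⇒P       : ∀ {y} → Q y → (c : Fin m → Fin t) → P (Vec.tabulate (λ j → pool j (c j))) y
      many      : length ys ≤ D * ∑[ y ∈ ys ] ⟦ Q? y ⟧

  -- One coordinate of Erdős' argument: by averaging, many `x` are related to at least `1 / (2 * D)`
  -- of the `y`; among those off `F`, pigeonhole finds `t′ + 1` that are related to many `y`
  -- simultaneously.
  choose : {P : A → B → Set} (P? : ∀ x y → Dec (P x y)) (t′ D : ℕ) (xs : List A) (ys : List B) (F : List V) →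
    0 < D → 0 < length ys → AllPairs _#_ xs →
    2 * D * (poolSource t′ D + length F) ≤ length xs →
    length xs * length ys ≤ D * ∑[ x ∈ xs ] ∑[ y ∈ ys ] ⟦ P? x y ⟧ →
    Σ (List A) λ g → g ⊑ xs × All (λ x → Disjoint (verts x) F) g × t′ < length g ×
      length ys ≤ stepDensity t′ D * ∑[ y ∈ ys ] ⟦ All.all? (λ x → P? x y) g ⟧
  choose {B = B} {P} P? t′ D xs ys F D>0 ys>0 sep large dense = result
    where
    open ≤-Reasoning
    instance
      2D≢0 : NonZero (2 * D)
      2D≢0 = >-nonZero (*-pos {2} (s≤s z≤n) D>0)
      ys≢0 : NonZero (length ys)
      ys≢0 = >-nonZero ys>0
    q = poolSource t′ D
    weight : A → ℕ
    weight x = ∑[ y ∈ ys ] ⟦ P? x y ⟧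
    Heavy : A → Set
    Heavy x = length ys ≤ 2 * D * weight x
    heavy? : ∀ x → Dec (Heavy x)
    heavy? x = length ys ≤? 2 * D * weight x
    heavies = filter heavy? xs
    heavy-or-light : ∀ x → 2 * D * weight x ≤ 2 * D * length ys * ⟦ heavy? x ⟧ + length ys
    heavy-or-light x with heavy? x
    ... | no light = ≤-trans (<⇒≤ (≰⇒> light)) (m≤n+m _ _)
    ... | yes _ = begin
      2 * D * weight x              ≤⟨ *-monoʳ-≤ (2 * D) (∑-bound ys (λ {y} _ → ⟦⟧≤1 (P? x y))) ⟩
      2 * D * (length ys * 1)       ≡⟨ sym (*-assoc (2 * D) _ 1) ⟩
      2 * D * length ys * 1         ≤⟨ m≤m+n _ _ ⟩
      2 * D * length ys * 1 + length ys ∎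
    many-heavy : length xs ≤ 2 * D * length heavies
    many-heavy = *-cancelʳ-≤ _ _ (length ys) (+-cancelʳ-≤ (length xs * length ys) _ _ (begin
      length xs * length ys + length xs * length ys ≡⟨ dbl (length xs * length ys) ⟩
      2 * (length xs * length ys)                   ≤⟨ *-monoʳ-≤ 2 dense ⟩
      2 * (D * ∑ xs weight)                         ≡⟨ sym (trans (∑-*ˡ (2 * D) xs weight) (*-assoc 2 D _)) ⟩
      ∑[ x ∈ xs ] (2 * D * weight x)                ≤⟨ ∑-mono xs (λ {x} _ → heavy-or-light x) ⟩
      ∑[ x ∈ xs ] (2 * D * length ys * ⟦ heavy? x ⟧ + length ys)
        ≡⟨ ∑-+ xs _ _ ⟩
      ∑[ x ∈ xs ] (2 * D * length ys * ⟦ heavy? x ⟧) + ∑[ x ∈ xs ] length ys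
        ≡⟨ cong₂ _+_ (∑-*ˡ (2 * D * length ys) xs _) (∑-const xs (length ys)) ⟩
      2 * D * length ys * ∑[ x ∈ xs ] ⟦ heavy? x ⟧ + length xs * length ys
        ≡⟨ cong (λ h → 2 * D * length ys * h + length xs * length ys) (sym (length-filter≡∑ heavy? xs)) ⟩
      2 * D * length ys * length heavies + length xs * length ys
        ≡⟨ cong (_+ length xs * length ys) (swp (2 * D) (length ys) (length heavies)) ⟩
      2 * D * length heavies * length ys + length xs * length ys ∎))
      where
      dbl : ∀ a → a + a ≡ 2 * a
      dbl = solve-∀
      swp : ∀ a b c → a * b * c ≡ a * c * b
      swp = solve-∀
    sep-heavies : AllPairs _#_ heavies
    sep-heavies = AllPairs-resp-⊑ (filter-⊆ heavy? xs) sep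
    hits? : ∀ x → Dec (Any (_∈ verts x) F)
    hits? x = Any.any? (_∈? verts x) F
    free = filter (λ x → ¬? (hits? x)) heavies
    enough : q ≤ length free
    enough = +-cancelʳ-≤ (length F) _ _ (≤-trans
      (*-cancelˡ-≤ (2 * D) (≤-trans large many-heavy))
      (avoid (λ x v → v ∈? verts x) heavies F (λ v → AllPairs.map (λ d p q → d (p , q)) sep-heavies)))
    -- Only boundedly many heavy entries are kept, so that the number `2 ^ q` of their sublists,
    -- hence the density lost to pigeonhole, does not depend on `length xs`.
    hs = take q free
    length-hs : length hs ≡ q
    length-hs = trans (length-take q free) (m≤n⇒m⊓n≡m enough)
    hs⊑free : hs ⊑ free
    hs⊑free = take-⊆ q free
    hs⊑heavies : hs ⊑ heavies
    hs⊑heavies = ⊆-trans hs⊑free (filter-⊆ _ heavies)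
    hs-heavy : All Heavy hs
    hs-heavy = All-resp-⊆ hs⊑heavies (all-filter heavy? xs)
    hs-avoid : All (λ x → Disjoint (verts x) F) hs
    hs-avoid = All.map (λ ¬hit {v} (v∈x , v∈F) → ¬hit (Any.map (λ { refl → v∈x }) v∈F))
                       (All-resp-⊆ hs⊑free (all-filter (λ x → ¬? (hits? x)) heavies))
    dense′ : (2 * D * t′ + 1) * length ys ≤ 2 * D * ∑[ y ∈ ys ] ∑[ h ∈ hs ] ⟦ P? h y ⟧
    dense′ = begin
      q * length ys                        ≡⟨ cong (_* length ys) (sym length-hs) ⟩
      length hs * length ys                ≤⟨ ∑-bound′ hs (λ h∈ → All.lookup hs-heavy h∈) ⟩
      ∑[ h ∈ hs ] (2 * D * weight h)       ≡⟨ ∑-*ˡ (2 * D) hs weight ⟩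
      2 * D * ∑ hs weight                  ≡⟨ cong (2 * D *_) (∑-swap hs ys _) ⟩
      2 * D * ∑[ y ∈ ys ] ∑[ h ∈ hs ] ⟦ P? h y ⟧ ∎
    result : Σ (List A) λ g → g ⊑ xs × All (λ x → Disjoint (verts x) F) g × t′ < length g ×
      length ys ≤ stepDensity t′ D * ∑[ y ∈ ys ] ⟦ All.all? (λ x → P? x y) g ⟧
    result = let g , g⊑hs , t′< , many = common-sublist P? t′ (2 * D) hs ys ys>0 dense′ in g , ⊆-trans g⊑hs (⊆-trans hs⊑heavies (filter-⊆ heavy? xs)) ,
      All-resp-⊆ g⊑hs hs-avoid , t′< ,
      subst (λ l → length ys ≤ 2 * D * l * 2 ^ l * ∑[ y ∈ ys ] ⟦ All.all? (λ h → P? h y) g ⟧) length-hs many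

  -- Induction on the coordinates. For the first one, the remaining coordinates count as part of the
  -- parameter; afterwards the relation is strengthened to hold for all of the chosen `g`, and the
  -- recursion runs with the smaller density.
  box : (t′ w m D : ℕ) → (∀ x → length (verts x) ≤ w) →
    {P : Vec A m → B → Set} (P? : ∀ v y → Dec (P v y)) (xs : List A) (ys : List B) (F : List V) →
    0 < D → 0 < length ys → AllPairs _#_ xs → boxSize t′ w m D (length F) ≤ length xs →
    length xs ^ m * length ys ≤ D * ∑[ v ∈ tuples xs m ] ∑[ y ∈ ys ] ⟦ P? v y ⟧ →
    Pools (suc t′) m xs F (boxDensity t′ m D) ys P
  box t′ w zero D w≥ {P} P? xs ys F D>0 ys>0 sep large dense = record
    { pool = λ ()
    ; pool∈ = λ ()
    ; avoids = λ ()
    ; separated = λ ()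
    ; Q = P []
    ; Q? = P? []
    ; Q⇒P = λ p _ → p
    ; many = subst₂ (λ a b → a ≤ D * b) (+-identityʳ _) (+-identityʳ _) dense
    }
  box {B = B} t′ w (suc m) D w≥ {P} P? xs ys F D>0 ys>0 sep large dense = assemble first
    where
    open ≤-Reasoning
    ys′ : List (Vec A m × B)
    ys′ = cartesianProduct (tuples xs m) ys
    ∑ys′ : (f : Vec A m × B → ℕ) → ∑ ys′ f ≡ ∑[ v ∈ tuples xs m ] ∑[ y ∈ ys ] f (v , y)
    ∑ys′ = ∑-cartesianProductWith _,_ (tuples xs m) ys
    length-ys′ : length ys′ ≡ length xs ^ m * length ys
    length-ys′ = begin-equality
      length ys′               ≡⟨ trans (length≡∑ ys′) (∑ys′ _) ⟩
      ∑[ v ∈ tuples xs m ] ∑ ys (λ _ → 1) ≡⟨ ∑-const (tuples xs m) _ ⟩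
      length (tuples xs m) * ∑ ys (λ _ → 1) ≡⟨ cong₂ _*_ (length-tuples xs m) (sym (length≡∑ ys)) ⟩
      length xs ^ m * length ys ∎
    xs>0 : 0 < length xs
    xs>0 = ≤-trans (*-pos (*-pos {2} (s≤s z≤n) D>0)
                     (≤-trans (subst (0 <_) (+-comm 1 (2 * D * t′)) (s≤s z≤n)) (m≤m+n _ (length F))))
                   (m⊔n≤o⇒m≤o _ _ large)
    P₁? : ∀ x (vy : Vec A m × B) → Dec (P (x ∷ proj₁ vy) (proj₂ vy))
    P₁? x (v , y) = P? (x ∷ v) y
    first = choose P₁? t′ D xs ys′ F D>0
      (subst (0 <_) (sym length-ys′) (*-pos (m^n>0 (length xs) {{>-nonZero xs>0}} m) ys>0))
      sep (m⊔n≤o⇒m≤o _ _ large)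
      (begin
        length xs * length ys′                  ≡⟨ cong (length xs *_) length-ys′ ⟩
        length xs * (length xs ^ m * length ys) ≡⟨ *-assoc (length xs) _ _ ⟨
        length xs ^ suc m * length ys           ≤⟨ dense ⟩
        D * ∑[ v ∈ tuples xs (suc m) ] ∑[ y ∈ ys ] ⟦ P? v y ⟧
          ≡⟨ cong (D *_) (∑-tuples xs _) ⟩
        D * ∑[ x ∈ xs ] ∑[ v ∈ tuples xs m ] ∑[ y ∈ ys ] ⟦ P? (x ∷ v) y ⟧
          ≡⟨ cong (D *_) (∑-cong xs (λ x → ∑ys′ (λ vy → ⟦ P₁? x vy ⟧))) ⟨
        D * ∑[ x ∈ xs ] ∑[ vy ∈ ys′ ] ⟦ P₁? x vy ⟧ ∎)
    assemble : (Σ (List A) λ g → g ⊑ xs × All (λ x → Disjoint (verts x) F) g × t′ < length g ×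
      length ys′ ≤ stepDensity t′ D * ∑[ vy ∈ ys′ ] ⟦ All.all? (λ x → P₁? x vy) g ⟧) →
      Pools (suc t′) (suc m) xs F (boxDensity t′ (suc m) D) ys P
    assemble (g , g⊑xs , g-avoid , t′< , many₁) = record
      { pool = λ { zero → pool₀ ; (suc j) → R.pool j }
      ; pool∈ = λ { zero i → ⊑-lookup g⊑xs (∈-lookup (inject≤ i t′<)) ; (suc j) → R.pool∈ j }
      ; avoids = λ { zero i → All.lookup g-avoid (∈-lookup (inject≤ i t′<))
                   ; (suc j) i (v∈ , v∈F) → R.avoids j i (v∈ , ∈-++⁺ˡ v∈F) }
      ; separated = λ
          { zero i zero i′ v∈ v∈′ → refl , sep₀ i i′ v∈ v∈′
          ; zero i (suc j′) i′ v∈ v∈′ → ⊥-elim (R.avoids j′ i′ (v∈′ , used i v∈))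
          ; (suc j) i zero i′ v∈ v∈′ → ⊥-elim (R.avoids j i (v∈ , used i′ v∈′))
          ; (suc j) i (suc j′) i′ v∈ v∈′ → let e , e′ = R.separated j i j′ i′ v∈ v∈′ in cong suc e , e′ }
      ; Q = R.Q
      ; Q? = R.Q?
      ; Q⇒P = λ q c → All.lookup (R.Q⇒P q (c ∘ suc)) (∈-lookup (inject≤ (c zero) t′<))
      ; many = R.many
      }
      where
      pool₀ : Fin (suc t′) → A
      pool₀ i = List.lookup g (inject≤ i t′<)
      sep₀ : ∀ i i′ {v} → v ∈ verts (pool₀ i) → v ∈ verts (pool₀ i′) → i ≡ i′
      sep₀ i i′ v∈ v∈′ with i Fin.≟ i′
      ... | yes e = e
      ... | no ne = ⊥-elim (AllPairs-lookup (λ {x} {y} → #-sym {x} {y}) (AllPairs-resp-⊑ g⊑xs sep) _ _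
                     (ne ∘ Fin.inject≤-injective t′< t′< i i′) (v∈ , v∈′))
      F₀ = concatMap (verts ∘ pool₀) (allFin (suc t′))
      -- The vertices just chosen become forbidden, which is what separates the pools of different
      -- coordinates.
      F′ = F ++ F₀
      used : ∀ i {v} → v ∈ verts (pool₀ i) → v ∈ F′
      used i v∈ = ∈-++⁺ʳ F (∈-concatMap⁺ (verts ∘ pool₀) (Any.map (λ { refl → v∈ }) (∈-allFin i)))
      length-F′ : length F′ ≤ length F + suc t′ * w
      length-F′ = begin
        length F′                   ≡⟨ length-++ F ⟩
        length F + length F₀        ≡⟨ cong (length F +_) (trans (length≡∑ F₀) (∑-concatMap (verts ∘ pool₀) (allFin (suc t′)) _)) ⟩
        length F + ∑[ i ∈ allFin (suc t′) ] ∑ (verts (pool₀ i)) (λ _ → 1)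
          ≤⟨ +-monoʳ-≤ (length F) (∑-bound (allFin (suc t′)) (λ {i} _ → ≤-trans (≤-reflexive (sym (length≡∑ (verts (pool₀ i))))) (w≥ (pool₀ i)))) ⟩
        length F + length (allFin (suc t′)) * w ≡⟨ cong (λ l → length F + l * w) (length-tabulate {n = suc t′} (λ i → i)) ⟩
        length F + suc t′ * w       ∎
      boxSize-mono : ∀ m D {f f′} → f ≤ f′ → boxSize t′ w m D f ≤ boxSize t′ w m D f′
      boxSize-mono zero    D f≤ = z≤n
      boxSize-mono (suc m) D f≤ = ⊔-mono-≤ (*-monoʳ-≤ (2 * D) (+-monoʳ-≤ _ f≤)) (boxSize-mono m _ (+-monoˡ-≤ _ f≤))
      P′ : Vec A m → B → Set
      P′ v y = All (λ x → P (x ∷ v) y) g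
      rest = box t′ w m (stepDensity t′ D) w≥ {P′} (λ v y → All.all? (λ x → P? (x ∷ v) y) g) xs ys F′
        (stepDensity>0 t′ D D>0) ys>0 sep
        (≤-trans (boxSize-mono m _ length-F′) (m⊔n≤o⇒n≤o _ _ large))
        (subst₂ (λ a b → a ≤ stepDensity t′ D * b) length-ys′ (∑ys′ _) many₁)
      module R = Pools rest

-- Matchings in blow-ups

transpose-left : (i j : Fin n) → transpose i j i ≡ j
transpose-left i j rewrite dec-true (i Fin.≟ i) refl = refl

transpose-other : {i j k : Fin n} → k ≢ i → k ≢ j → transpose i j k ≡ k
transpose-other {i = i} {j} {k} k≢i k≢j rewrite dec-false (k Fin.≟ i) k≢i | dec-false (k Fin.≟ j) k≢j = refl

transpose-injective : (i j : Fin n) {k l : Fin n} → transpose i j k ≡ transpose i j l → k ≡ l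
transpose-injective i j e =
  trans (sym (transpose-inverse j i)) (trans (cong (transpose j i) e) (transpose-inverse j i))

-- Transpose `a` to `c` first, then the image of `b` to `d`; the second transposition fixes `c`,
-- which differs from both of its points.
two-point-permutation : {a b c d : Fin n} → a ≢ b → c ≢ d →
  Σ (Fin n → Fin n) λ π → (∀ {i j} → π i ≡ π j → i ≡ j) × π a ≡ c × π b ≡ d
two-point-permutation {a = a} {b} {c} {d} a≢b c≢d =
  σ ∘ τ , transpose-injective a c ∘ transpose-injective (τ b) d ,
  trans (cong σ (transpose-left a c)) (transpose-other c≢τb c≢d) , transpose-left (τ b) d
  where
  τ = transpose a c
  σ = transpose (τ b) d
  c≢τb : c ≢ τ b
  c≢τb e = a≢b (transpose-injective a c (trans (transpose-left a c) e))

encode : {k : ℕ} → Vec (Fin k) m → Fin (k ^ m)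
encode []      = zero
encode (x ∷ v) = combine x (encode v)

encode-injective : {k : ℕ} (v w : Vec (Fin k) m) → encode v ≡ encode w → v ≡ w
encode-injective []      []      _ = refl
encode-injective (x ∷ v) (y ∷ w) e with Fin.combine-injective x (encode v) y (encode w) e
... | refl , e′ = cong (x ∷_) (encode-injective v w e′)

removeAt-injective : (v w : Vec A (suc n)) (i : Fin (suc n)) →
  lookup v i ≡ lookup w i → removeAt v i ≡ removeAt w i → v ≡ w
removeAt-injective v w i e e′ = begin
  v                                      ≡⟨ insertAt-removeAt v i ⟨
  insertAt (removeAt v i) i (lookup v i) ≡⟨ cong₂ (λ u z → insertAt u i z) e′ e ⟩
  insertAt (removeAt w i) i (lookup w i) ≡⟨ insertAt-removeAt w i ⟩
  w                                      ∎
  where open ≡-Reasoning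

tuples⁺ : {xs : List A} → Unique xs → Unique (tuples xs m)
tuples⁺ {m = zero}  u = [] ∷ []
tuples⁺ {m = suc m} u = Unique.cartesianProductWith⁺ _∷_ ∷-injective u (tuples⁺ u)

allTuples : (k m : ℕ) → List (Vec (Fin k) m)
allTuples k m = tuples (allFin k) m

∈-allTuples : {k : ℕ} (v : Vec (Fin k) m) → v ∈ allTuples k m
∈-allTuples v = ∈-tuples v (λ i → ∈-allFin (lookup v i))

length-allTuples : (k m : ℕ) → length (allTuples k m) ≡ k ^ m
length-allTuples k m = trans (length-tuples (allFin k) m) (cong (_^ m) (length-tabulate {n = k} (λ i → i)))

-- With `k = N + 1` and `r = 2 + s` this is the bound on k^r - (k-1)^r from the overview. For
-- exponent 1 equality would hold, so strictness rests on r ≥ 2, that is, on d ≤ k - 2.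
power-gap : ∀ N s → suc N ^ (2 + s) < N ^ (2 + s) + (2 + s) * suc N ^ suc s
power-gap N zero    = ≤-reflexive (square N)
  where
  square : ∀ N → suc (suc N * (suc N * 1)) ≡ N * (N * 1) + 2 * (suc N * 1)
  square = solve-∀
power-gap N (suc s) = begin-strict
  suc N * suc N ^ (2 + s)   <⟨ *-monoʳ-< (suc N) (power-gap N s) ⟩
  suc N * (N ^ (2 + s) + (2 + s) * suc N ^ suc s) ≡⟨ expand N (N ^ (2 + s)) s (suc N ^ suc s) ⟩
  N * N ^ (2 + s) + (N ^ (2 + s) + (2 + s) * suc N ^ (2 + s))
    ≤⟨ +-monoʳ-≤ (N ^ (3 + s)) (+-monoˡ-≤ _ (^-monoˡ-≤ (2 + s) (n≤1+n N))) ⟩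
  N ^ (3 + s) + (suc N ^ (2 + s) + (2 + s) * suc N ^ (2 + s)) ∎
  where
  open ≤-Reasoning
  expand : ∀ N a s b → suc N * (a + (2 + s) * b) ≡ N * a + (a + (2 + s) * (suc N * b))
  expand = solve-∀

-- A matching with L edges in the t-fold blow-up of g (edge i uses copy
-- copyOf i j of its vertex in part j), meeting fewer than L of the copies of the parts.
record BlowUpMatching (k r t : ℕ) (g : List (Vec (Fin k) r)) : Set where
  field
    L        : ℕ
    word     : Fin L → Vec (Fin k) r
    word∈    : ∀ i → word i ∈ g
    copyOf   : Fin L → Fin r → Fin t
    used     : List (Fin r × Fin t)
    copyOf∈  : ∀ i j → (j , copyOf i j) ∈ used
    few-used : length used < L
    L≤t      : L ≤ t
    distinct : ∀ i i′ j → copyOf i j ≡ copyOf i′ j → lookup (word i) j ≡ lookup (word i′) j → i ≡ i′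

module BlowUps {K r₀ t : ℕ} (g : List (Vec (Fin (suc K)) (2 + r₀))) (g! : Unique g) where

  private
    k = suc K
    r = 2 + r₀

    _≟ᵛ_ : DecidableEquality (Vec (Fin k) r)
    _≟ᵛ_ = Data.Vec.Properties.≡-dec Fin._≟_
      where import Data.Vec.Properties

  open import Data.List.Membership.DecPropositional _≟ᵛ_ using (_∈?_)

  Full : Fin r → Fin k → Set
  Full j v = All (λ x → lookup x j ≡ v → x ∈ g) (allTuples k r)

  full? : ∀ j v → Dec (Full j v)
  full? j v = All.all? (λ x → (lookup x j Fin.≟ v) →-dec (x ∈? g)) (allTuples k r)

  Full⇒∈ : ∀ {j v} → Full j v → ∀ {x} → lookup x j ≡ v → x ∈ g
  Full⇒∈ full {x} = All.lookup full (∈-allTuples x)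

  missing : ∀ {j v} → ¬ Full j v → ∃[ x ] lookup x j ≡ v × x ∉ g
  missing {j} {v} ¬full with Any.satisfied (¬All⇒Any¬ (λ x → (lookup x j Fin.≟ v) →-dec (x ∈? g)) _ ¬full)
  ... | x , ¬imp with lookup x j Fin.≟ v | x ∈? g
  ... | yes e | no x∉g  = x , e , x∉g
  ... | yes e | yes x∈g = contradiction (λ _ → x∈g) ¬imp
  ... | no ne | _       = contradiction (λ e → contradiction e ne) ¬imp

  private
    length-g≤ : length g ≤ k ^ r
    length-g≤ = subst (length g ≤_) (length-allTuples k r) (length≤-inclusion g! (λ {x} _ → ∈-allTuples x))

  -- Every x ∈ g is used once, its copy in part j being named by the other
  -- coordinates of x; in part i one copy is saved by skipping, for each v, the
  -- name of a tuple through v that is missing from g.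
  blowUp-noFull : (i : Fin r) → (∀ v → ¬ Full i v) → k ^ r ≤ t → r * k ^ suc r₀ ≤ length g → BlowUpMatching k r t g
  blowUp-noFull i none k^r≤t g-large = record
    { L = length g
    ; word = List.lookup g
    ; word∈ = ∈-lookup
    ; copyOf = λ a → copy (List.lookup g a) (∈-lookup a)
    ; used = used
    ; copyOf∈ = λ a j → copy∈ (List.lookup g a) (∈-lookup a) j
    ; few-used = <-≤-trans (≤-reflexive (cong suc length-used)) (≤-trans (≤-reflexive (arith r₀ K′)) (subst (λ z → r * z ≤ length g) (sym 1+K′) g-large))
    ; L≤t = ≤-trans length-g≤ k^r≤t
    ; distinct = λ a b j eC eX → lookup-injective a b
        (copy-injective (List.lookup g a) (List.lookup g b) (∈-lookup a) (∈-lookup b) j eC eX)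
    }
    where
    instance
      K≢0 : NonZero (k ^ suc r₀)
      K≢0 = m^n≢0 k (suc r₀)
    K′ = pred (k ^ suc r₀)
    1+K′ : suc K′ ≡ k ^ suc r₀
    1+K′ = suc-pred (k ^ suc r₀)
    K≤t : suc K′ ≤ t
    K≤t = ≤-trans (≤-reflexive 1+K′) (≤-trans (m≤n*m (k ^ suc r₀) k) k^r≤t)
    K′≤t : K′ ≤ t
    K′≤t = <⇒≤ K≤t
    -- A copy in part `j` is named by the coordinates other than `j`, so two tuples that land on the
    -- same vertex of the same copy coincide.
    code : Fin r → Vec (Fin k) r → Fin (suc K′)
    code j x = cast (sym 1+K′) (encode (removeAt x j))
    code-injective : ∀ j x y → lookup x j ≡ lookup y j → code j x ≡ code j y → x ≡ y
    code-injective j x y e e′ = removeAt-injective x y j e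
      (encode-injective _ _ (Fin.toℕ-injective (trans (sym (Fin.toℕ-cast _ (encode (removeAt x j)))) (trans (cong toℕ e′) (Fin.toℕ-cast _ (encode (removeAt y j)))))))
    gap : Fin k → Fin (suc K′)
    gap v = code i (proj₁ (missing (none v)))
    gap≢ : ∀ v x → lookup x i ≡ v → x ∈ g → gap v ≢ code i x
    gap≢ v x e x∈g eq with missing (none v)
    ... | y , ey , y∉g = y∉g (subst (_∈ g) (sym (code-injective i y x (trans ey (sym e)) eq)) x∈g)
    -- The skipped name depends on the value `v` at `i`. Tuples with different values may thus share
    -- a copy, but they use different vertices of it; in all, `K′` copies suffice in part `i`.
    squeeze : ∀ v x → lookup x i ≡ v → x ∈ g → Fin K′
    squeeze v x e x∈g = punchOut (gap≢ v x e x∈g)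
    squeeze-injective : ∀ {v w} x y ex ey p q → v ≡ w → squeeze v x ex p ≡ squeeze w y ey q → x ≡ y
    squeeze-injective {v} x y ex ey p q refl e =
      code-injective i x y (trans ex (sym ey)) (Fin.punchOut-injective (gap≢ v x ex p) (gap≢ v y ey q) e)
    copy : ∀ x → x ∈ g → Fin r → Fin t
    copy x x∈g j with j Fin.≟ i
    ... | yes _ = inject≤ (squeeze _ x refl x∈g) K′≤t
    ... | no  _ = inject≤ (code j x) K≤t
    copy-injective : ∀ x y p q j → copy x p j ≡ copy y q j → lookup x j ≡ lookup y j → x ≡ y
    copy-injective x y p q j e e′ with j Fin.≟ i
    ... | yes refl = squeeze-injective x y refl refl p q e′ (Fin.inject≤-injective _ _ _ _ e)
    ... | no  _    = code-injective j x y e′ (Fin.inject≤-injective _ _ _ _ e)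
    others = cartesianProductWith (λ j c → punchIn i j , inject≤ c K≤t) (allFin (suc r₀)) (allFin (suc K′))
    own    = map (λ c → i , inject≤ c K′≤t) (allFin K′)
    used   = others ++ own
    length-used : length used ≡ suc r₀ * suc K′ + K′
    length-used = trans (length-++ others)
      (cong₂ _+_ (trans (length-cartesianProductWith _ (allFin (suc r₀)) (allFin (suc K′)))
                        (cong₂ _*_ (length-tabulate {n = suc r₀} id) (length-tabulate {n = suc K′} id)))
                 (trans (length-map _ (allFin K′)) (length-tabulate {n = K′} id)))
    arith : ∀ r K → suc (suc r * suc K + K) ≡ (2 + r) * suc K
    arith = solve-∀
    copy∈ : ∀ x p j → (j , copy x p j) ∈ used
    copy∈ x p j with j Fin.≟ i
    ... | yes refl = ∈-++⁺ʳ others (∈-map⁺ (λ c → i , inject≤ c K′≤t) (∈-allFin (squeeze _ x refl p)))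
    ... | no j≢i = ∈-++⁺ˡ (subst (λ z → (z , inject≤ (code j x) K≤t) ∈ others) (Fin.punchIn-punchOut (j≢i ∘ sym))
                     (∈-cartesianProductWith⁺ (λ j c → punchIn i j , inject≤ c K≤t) (∈-allFin (punchOut (j≢i ∘ sym))) (∈-allFin (code j x))))
    lookup-injective : ∀ a b → List.lookup g a ≡ List.lookup g b → a ≡ b
    lookup-injective a b e with a Fin.≟ b
    ... | yes a≡b = a≡b
    ... | no  a≢b = contradiction e (AllPairs-lookup (λ ne → ne ∘ sym) g! a b a≢b)

  Dodges : (Fin r → Fin k) → Vec (Fin k) r → Set
  Dodges v y = ∀ j → lookup y j ≢ v j

  dodges? : ∀ v y → Dec (Dodges v y)
  dodges? v y = Fin.all? (λ j → ¬? (lookup y j Fin.≟ v j))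

  some-dodges : (v : Fin r → Fin k) → r * k ^ suc r₀ ≤ length g → Any (Dodges v) g
  some-dodges v g-large with Any.any? (dodges? v) g
  ... | yes some = some
  ... | no  none = contradiction (<-≤-trans (power-gap K r₀) (≤-trans (+-monoʳ-≤ (K ^ r) g-large) too-many)) (<-irrefl refl)
    where
    -- `punchIn` lists the `K ^ r` tuples that dodge `v`; if `g` contained none of them, the two
    -- lists together would be too long for the `k ^ r` tuples available.
    dodge : Vec (Fin K) r → Vec (Fin k) r
    dodge w = tabulate (λ j → punchIn (v j) (lookup w j))
    lookup-dodge : ∀ w j → lookup (dodge w) j ≡ punchIn (v j) (lookup w j)
    lookup-dodge w = lookup∘tabulate (λ j → punchIn (v j) (lookup w j))
    dodge-dodges : ∀ w → Dodges v (dodge w)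
    dodge-dodges w j e = Fin.punchInᵢ≢i (v j) (lookup w j) (trans (sym (lookup-dodge w j)) e)
    dodge-injective : ∀ {w w′} → dodge w ≡ dodge w′ → w ≡ w′
    dodge-injective {w} {w′} e = trans (sym (tabulate∘lookup w)) (trans
      (tabulate-cong (λ j → Fin.punchIn-injective (v j) (lookup w j) (lookup w′ j)
        (trans (sym (lookup-dodge w j)) (trans (cong (λ u → lookup u j) e) (lookup-dodge w′ j)))))
      (tabulate∘lookup w′))
    dodgers = map dodge (allTuples K r)
    disjoint : Disjoint dodgers g
    disjoint (y∈ , y∈g) with ∈-map⁻ dodge y∈
    ... | w , _ , refl = none (Any.map (λ { refl → dodge-dodges w }) y∈g)
    too-many : K ^ r + length g ≤ k ^ r
    too-many = begin
      K ^ r + length g               ≡⟨ cong (_+ length g) (trans (sym (length-allTuples K r)) (sym (length-map dodge (allTuples K r)))) ⟩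
      length dodgers + length g      ≡⟨ length-++ dodgers ⟨
      length (dodgers ++ g)          ≤⟨ length≤-inclusion (Unique.++⁺ (Unique.map⁺ dodge-injective (tuples⁺ (Unique.allFin⁺ K))) g! disjoint) (λ {x} _ → ∈-allTuples x) ⟩
      length (allTuples k r)         ≡⟨ length-allTuples k r ⟩
      k ^ r                          ∎
      where open ≤-Reasoning

  -- A tuple of g avoiding the full vertices v j, together with one tuple
  -- through each of them, the remaining coordinates being chosen apart.
  blowUp-allFull : (v : Fin r → Fin k) → (∀ j → Full j (v j)) → r < k → r < t → r * k ^ suc r₀ ≤ length g → BlowUpMatching k r t g
  blowUp-allFull v full r<k r<t g-large = record
    { L = suc r
    ; word = word
    ; word∈ = word∈
    ; copyOf = λ _ _ → c₀
    ; used = map (_, c₀) (allFin r)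
    ; copyOf∈ = λ _ j → ∈-map⁺ (_, c₀) (∈-allFin j)
    ; few-used = s≤s (≤-reflexive (trans (length-map (_, c₀) (allFin r)) (length-tabulate {n = r} id)))
    ; L≤t = r<t
    ; distinct = λ i i′ j _ e → Fin.inject≤-injective r<k r<k i i′
        (proj₁ (proj₂ (perm j)) (trans (sym (lookup-word i j)) (trans e (lookup-word i′ j))))
    }
    where
    c₀ : Fin t
    c₀ = Fin.fromℕ< {0} (≤-trans (s≤s z≤n) r<t)
    some = some-dodges v g-large
    y = Any.lookup some
    y∈g : y ∈ g
    y∈g = ∈-lookup (Any.index some)
    y-dodges : Dodges v y
    y-dodges = lookup-result some
    index : Fin (suc r) → Fin k
    index i = inject≤ i r<k
    0≢suc : ∀ j → index zero ≢ index (suc j)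
    0≢suc j e with Fin.inject≤-injective r<k r<k zero (suc j) e
    ... | ()
    -- Coordinate `j` of all `r + 1` words comes from one injection on indices, which makes the
    -- words disjoint. Index `0` goes to `y`, so word `0` is `y`; index `suc j` goes to `v j`, so
    -- word `suc j` lies in `g` by fullness.
    perm : ∀ j → Σ (Fin k → Fin k) λ π → (∀ {i i′} → π i ≡ π i′ → i ≡ i′) × π (index zero) ≡ lookup y j × π (index (suc j)) ≡ v j
    perm j = two-point-permutation (0≢suc j) (y-dodges j)
    word : Fin (suc r) → Vec (Fin k) r
    word i = tabulate (λ j → proj₁ (perm j) (index i))
    lookup-word : ∀ i j → lookup (word i) j ≡ proj₁ (perm j) (index i)
    lookup-word i = lookup∘tabulate (λ j → proj₁ (perm j) (index i))
    word∈ : ∀ i → word i ∈ g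
    word∈ zero    = subst (_∈ g) (sym (trans (tabulate-cong (λ j → proj₁ (proj₂ (proj₂ (perm j))))) (tabulate∘lookup y))) y∈g
    word∈ (suc j) = Full⇒∈ (full j) (trans (lookup-word (suc j) j) (proj₂ (proj₂ (proj₂ (perm j)))))

  blowUp : r < k → k ^ r ≤ t → r * k ^ suc r₀ ≤ length g → BlowUpMatching k r t g
  blowUp r<k k^r≤t g-large with Fin.all? (λ j → Fin.any? (full? j))
  ... | yes full = blowUp-allFull (λ j → proj₁ (full j)) (λ j → proj₂ (full j)) r<k
                     (≤-trans (≤-trans r<k (m≤m*n k (k ^ suc r₀) {{m^n≢0 k (suc r₀)}})) k^r≤t) g-large
  ... | no ¬full with Fin.¬∀⟶∃¬ r _ (λ j → Fin.any? (full? j)) ¬full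
  ... | i , none = blowUp-noFull i (λ v f → none (v , f)) k^r≤t g-large

-- Tuples and subsets

elements : Subset n → List (Fin n)
elements []            = []
elements (outside ∷ p) = map suc (elements p)
elements (inside ∷ p)  = zero ∷ map suc (elements p)

length-elements : (p : Subset n) → length (elements p) ≡ ∣ p ∣
length-elements []            = refl
length-elements (outside ∷ p) = trans (length-map suc (elements p)) (length-elements p)
length-elements (inside ∷ p)  = cong suc (trans (length-map suc (elements p)) (length-elements p))

∈-elements⁺ : {p : Subset n} {x : Fin n} → x ∈ˢ p → x ∈ elements p
∈-elements⁺ {p = inside ∷ p}  Vec.here      = here refl
∈-elements⁺ {p = inside ∷ p}  (Vec.there q) = there (∈-map⁺ suc (∈-elements⁺ q))
∈-elements⁺ {p = outside ∷ p} (Vec.there q) = ∈-map⁺ suc (∈-elements⁺ q)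

∈-elements⁻ : {p : Subset n} {x : Fin n} → x ∈ elements p → x ∈ˢ p
∈-elements⁻ {p = inside ∷ p} (here refl) = Vec.here
∈-elements⁻ {p = inside ∷ p} (there q) with ∈-map⁻ suc q
... | _ , r , refl = Vec.there (∈-elements⁻ r)
∈-elements⁻ {p = outside ∷ p} q with ∈-map⁻ suc q
... | _ , r , refl = Vec.there (∈-elements⁻ r)

elements⁺ : (p : Subset n) → Unique (elements p)
elements⁺ []            = []
elements⁺ (outside ∷ p) = Unique.map⁺ Fin.suc-injective (elements⁺ p)
elements⁺ (inside ∷ p)  = All.tabulate (λ q e → zero∉ (subst (_∈ map suc (elements p)) (sym e) q)) ∷ Unique.map⁺ Fin.suc-injective (elements⁺ p)
  where
  zero∉ : zero ∉ map suc (elements p)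
  zero∉ q with ∈-map⁻ suc q
  ... | _ , _ , ()

support : Vec (Fin n) m → Subset n
support []      = ∅
support (x ∷ v) = ⁅ x ⁆ ∪ support v

∈-support⁺ : {x : Fin n} (v : Vec (Fin n) m) → x ∈ Vec.toList v → x ∈ˢ support v
∈-support⁺ (y ∷ v) (here refl) = x∈p∪q⁺ (inj₁ (x∈⁅x⁆ y))
∈-support⁺ (y ∷ v) (there p)   = x∈p∪q⁺ (inj₂ (∈-support⁺ v p))

∈-support⁻ : {x : Fin n} (v : Vec (Fin n) m) → x ∈ˢ support v → x ∈ Vec.toList v
∈-support⁻ []      p = ⊥-elim (∉⊥ p)
∈-support⁻ (y ∷ v) p with x∈p∪q⁻ ⁅ y ⁆ (support v) p
... | inj₁ q = here (x∈⁅y⁆⇒x≡y y q)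
... | inj₂ q = there (∈-support⁻ v q)

support-++ : {l : ℕ} (v : Vec (Fin n) m) (w : Vec (Fin n) l) → support (v Vec.++ w) ≡ support v ∪ support w
support-++ []      w = sym (∪-identityˡ _)
support-++ (x ∷ v) w = trans (cong (⁅ x ⁆ ∪_) (support-++ v w)) (sym (∪-assoc ⁅ x ⁆ (support v) (support w)))

∣p∣≤length : (p : Subset n) (xs : List (Fin n)) → (∀ {x} → x ∈ˢ p → x ∈ xs) → ∣ p ∣ ≤ length xs
∣p∣≤length p xs sub = subst (_≤ length xs) (length-elements p) (length≤-inclusion (elements⁺ p) (sub ∘ ∈-elements⁻))

length≤∣p∣ : (p : Subset n) (xs : List (Fin n)) → Unique xs → (∀ {x} → x ∈ xs → x ∈ˢ p) → length xs ≤ ∣ p ∣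
length≤∣p∣ p xs u sub = subst (length xs ≤_) (length-elements p) (length≤-inclusion u (∈-elements⁺ ∘ sub))

∣support∣≤ : (v : Vec (Fin n) m) → ∣ support v ∣ ≤ m
∣support∣≤ v = subst (∣ support v ∣ ≤_) (length-toList v) (∣p∣≤length _ _ (∈-support⁻ v))

Unique⇒∣support∣ : (v : Vec (Fin n) m) → Unique (Vec.toList v) → ∣ support v ∣ ≡ m
Unique⇒∣support∣ v u = ≤-antisym (∣support∣≤ v) (subst (_≤ ∣ support v ∣) (length-toList v) (length≤∣p∣ _ _ u (∈-support⁺ v)))

∣support∣⇒head∉ : (x : Fin n) (v : Vec (Fin n) m) → ∣ support (x ∷ v) ∣ ≡ suc m → x ∉ Vec.toList v
∣support∣⇒head∉ {m = m} x v e p = <-irrefl refl (subst₂ _≤_ e (length-toList v) (∣p∣≤length (support (x ∷ v)) (Vec.toList v) absorb))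
  where
  absorb : ∀ {y} → y ∈ˢ support (x ∷ v) → y ∈ Vec.toList v
  absorb q with ∈-support⁻ (x ∷ v) q
  ... | here refl = p
  ... | there r   = r

∣support∣⇒tail : (x : Fin n) (v : Vec (Fin n) m) → ∣ support (x ∷ v) ∣ ≡ suc m → ∣ support v ∣ ≡ m
∣support∣⇒tail x v e = ≤-antisym (∣support∣≤ v) (≤-pred (subst₂ _≤_ e (cong suc (length-elements (support v)))
  (∣p∣≤length (support (x ∷ v)) (x ∷ elements (support v)) sub)))
  where
  sub : ∀ {y} → y ∈ˢ support (x ∷ v) → y ∈ x ∷ elements (support v)
  sub q with ∈-support⁻ (x ∷ v) q
  ... | here refl = here refl
  ... | there r   = there (∈-elements⁺ (∈-support⁺ v r))

∣support∣⇒Unique : (v : Vec (Fin n) m) → ∣ support v ∣ ≡ m → Unique (Vec.toList v)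
∣support∣⇒Unique []      e = []
∣support∣⇒Unique (x ∷ v) e = All.tabulate (λ { p refl → ∣support∣⇒head∉ x v e p }) ∷ ∣support∣⇒Unique v (∣support∣⇒tail x v e)

∣p∣≡∣q∣+∣p─q∣ : (p q : Subset n) → q ⊆ˢ p → ∣ p ∣ ≡ ∣ q ∣ + ∣ p ─ q ∣
∣p∣≡∣q∣+∣p─q∣ []            []            s = refl
∣p∣≡∣q∣+∣p─q∣ (outside ∷ p) (outside ∷ q) s = ∣p∣≡∣q∣+∣p─q∣ p q (drop-∷-⊆ s)
∣p∣≡∣q∣+∣p─q∣ (inside ∷ p)  (outside ∷ q) s = trans (cong suc (∣p∣≡∣q∣+∣p─q∣ p q (drop-∷-⊆ s))) (sym (+-suc ∣ q ∣ _))
∣p∣≡∣q∣+∣p─q∣ (inside ∷ p)  (inside ∷ q)  s = cong suc (∣p∣≡∣q∣+∣p─q∣ p q (drop-∷-⊆ s))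
∣p∣≡∣q∣+∣p─q∣ (outside ∷ p) (inside ∷ q)  s with s Vec.here
... | ()

q∪[p─q]≡p : (p q : Subset n) → q ⊆ˢ p → q ∪ (p ─ q) ≡ p
q∪[p─q]≡p p q s = ⊆-antisym to from
  where
  to : q ∪ (p ─ q) ⊆ˢ p
  to x∈ with x∈p∪q⁻ q (p ─ q) x∈
  ... | inj₁ x∈q = s x∈q
  ... | inj₂ x∈p─q = p─q⊆p p q x∈p─q
  from : p ⊆ˢ q ∪ (p ─ q)
  from {x} x∈p with x ∈ˢ? q
  ... | yes x∈q = x∈p∪q⁺ (inj₁ x∈q)
  ... | no  x∉q = x∈p∪q⁺ (inj₂ (x∈p∧x∉q⇒x∈p─q x∈p x∉q))

x∈p─q⇒x∉q : (p q : Subset n) {x : Fin n} → x ∈ˢ p ─ q → x ∉ˢ q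
x∈p─q⇒x∉q (_ ∷ p) (outside ∷ q) (Vec.there r) (Vec.there s) = x∈p─q⇒x∉q p q r s
x∈p─q⇒x∉q (_ ∷ p) (inside ∷ q)  (Vec.there r) (Vec.there s) = x∈p─q⇒x∉q p q r s

[q∪p]─q≡p : (p q : Subset n) → (∀ {x} → x ∈ˢ q → x ∉ˢ p) → (q ∪ p) ─ q ≡ p
[q∪p]─q≡p p q disj = ⊆-antisym to (λ x∈p → x∈p∧x∉q⇒x∈p─q (x∈p∪q⁺ (inj₂ x∈p)) (λ x∈q → disj x∈q x∈p))
  where
  to : (q ∪ p) ─ q ⊆ˢ p
  to x∈ with x∈p∪q⁻ q p (p─q⊆p (q ∪ p) q x∈)
  ... | inj₁ x∈q = ⊥-elim (x∈p─q⇒x∉q (q ∪ p) q x∈ x∈q)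
  ... | inj₂ x∈p = x∈p

⁅x⁆⊆p : {x : Fin n} {p : Subset n} → x ∈ˢ p → ⁅ x ⁆ ⊆ˢ p
⁅x⁆⊆p {x = x} {p} x∈p y∈ = subst (_∈ˢ p) (sym (x∈⁅y⁆⇒x≡y x y∈)) x∈p

_≟ˢ_ : (p q : Subset n) → Dec (p ≡ q)
_≟ˢ_ = Vec.≡-dec Bool._≟_

∣p─⁅x⁆∣ : (p : Subset n) (x : Fin n) → x ∈ˢ p → ∣ p ∣ ≡ suc m → ∣ p ─ ⁅ x ⁆ ∣ ≡ m
∣p─⁅x⁆∣ p x x∈p e = suc-injective (trans (sym (trans (∣p∣≡∣q∣+∣p─q∣ p ⁅ x ⁆ (⁅x⁆⊆p x∈p)) (cong (_+ ∣ p ─ ⁅ x ⁆ ∣) (∣⁅x⁆∣≡1 x)))) e)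

-- The head of such a tuple lies in `S`, and its tail has support `S ─ ⁅ x ⁆`, since a support of
-- full size rules out a repeated head. This bound serves the bad sets, the reverse one the degrees.
orderings≤ : (m : ℕ) (S : Subset n) → ∣ S ∣ ≡ m → ∑[ s ∈ allTuples n m ] ⟦ support s ≟ˢ S ⟧ ≤ m !
orderings≤ zero    S e = +-mono-≤ (⟦⟧≤1 (∅ ≟ˢ S)) z≤n
orderings≤ {n} (suc m) S e = begin
  ∑[ s ∈ allTuples n (suc m) ] ⟦ support s ≟ˢ S ⟧ ≡⟨ ∑-tuples (allFin n) _ ⟩
  ∑[ x ∈ allFin n ] ∑[ s ∈ allTuples n m ] ⟦ support (x ∷ s) ≟ˢ S ⟧ ≤⟨ ∑-mono (allFin n) (λ {x} _ → first x) ⟩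
  ∑[ x ∈ allFin n ] (m ! * ⟦ x ∈ˢ? S ⟧)   ≡⟨ ∑-*ˡ (m !) (allFin n) _ ⟩
  m ! * ∑[ x ∈ allFin n ] ⟦ x ∈ˢ? S ⟧     ≡⟨ cong (m ! *_) (length-filter≡∑ (_∈ˢ? S) (allFin n)) ⟨
  m ! * length (filter (_∈ˢ? S) (allFin n)) ≤⟨ *-monoʳ-≤ (m !) (length≤∣p∣ S _ (Unique.filter⁺ (_∈ˢ? S) (Unique.allFin⁺ n)) (proj₂ ∘ ∈-filter⁻ (_∈ˢ? S) {xs = allFin n})) ⟩
  m ! * ∣ S ∣                             ≡⟨ trans (cong (m ! *_) e) (*-comm (m !) (suc m)) ⟩
  suc m * m !                             ∎
  where
  open ≤-Reasoning
  first : ∀ x → ∑[ s ∈ allTuples n m ] ⟦ support (x ∷ s) ≟ˢ S ⟧ ≤ m ! * ⟦ x ∈ˢ? S ⟧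
  first x with x ∈ˢ? S
  ... | no x∉S = ≤-trans (∑-bound (allTuples n m) (λ {s} _ → none s)) (≤-reflexive (trans (*-zeroʳ (length (allTuples n m))) (sym (*-zeroʳ (m !)))))
    where
    none : ∀ s → ⟦ support (x ∷ s) ≟ˢ S ⟧ ≤ 0
    none s with support (x ∷ s) ≟ˢ S
    ... | yes eq = contradiction (subst (x ∈ˢ_) eq (x∈p∪q⁺ (inj₁ (x∈⁅x⁆ x)))) x∉S
    ... | no _ = z≤n
  ... | yes x∈S = ≤-trans (∑-mono (allTuples n m) (λ {s} _ → ⟦⟧-mono (support (x ∷ s) ≟ˢ S) (support s ≟ˢ (S ─ ⁅ x ⁆)) (rest s)))
                    (≤-trans (orderings≤ m (S ─ ⁅ x ⁆) (∣p─⁅x⁆∣ S x x∈S e)) (≤-reflexive (sym (*-identityʳ (m !)))))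
    where
    rest : ∀ s → support (x ∷ s) ≡ S → support s ≡ S ─ ⁅ x ⁆
    rest s eq = trans (sym ([q∪p]─q≡p (support s) ⁅ x ⁆ (λ y∈⁅x⁆ y∈s → ∣support∣⇒head∉ x s (trans (cong ∣_∣ eq) e)
      (∈-support⁻ s (subst (_∈ˢ support s) (x∈⁅y⁆⇒x≡y x y∈⁅x⁆) y∈s))))) (cong (_─ ⁅ x ⁆) eq)

orderings≥ : (m : ℕ) (S : Subset n) → ∣ S ∣ ≡ m → m ! ≤ ∑[ s ∈ allTuples n m ] ⟦ support s ≟ˢ S ⟧
orderings≥ {n} zero S e = ≤-reflexive (sym (cong (_+ 0) (⟦⟧≡1 (∅ ≟ˢ S) (⊆-antisym (λ p → ⊥-elim (∉⊥ p)) (λ {x} p → ⊥-elim (empty p))))))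
  where
  empty : ∀ {x} → x ∈ˢ S → ⊥
  empty p with elements S | trans (length-elements S) e | ∈-elements⁺ p
  ... | [] | _ | ()
orderings≥ {n} (suc m) S e = begin
  suc m * m !                             ≡⟨ cong (_* m !) (trans (sym e) (sym (length-elements S))) ⟩
  length (elements S) * m !               ≤⟨ ∑-bound′ (elements S) (λ {x} x∈ → first x (∈-elements⁻ x∈)) ⟩
  ∑[ x ∈ elements S ] ∑[ s ∈ allTuples n m ] ⟦ support (x ∷ s) ≟ˢ S ⟧ ≤⟨ ∑-inclusion (elements⁺ S) (λ {x} _ → ∈-allFin x) _ ⟩
  ∑[ x ∈ allFin n ] ∑[ s ∈ allTuples n m ] ⟦ support (x ∷ s) ≟ˢ S ⟧ ≡⟨ ∑-tuples (allFin n) _ ⟨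
  ∑[ s ∈ allTuples n (suc m) ] ⟦ support s ≟ˢ S ⟧ ∎
  where
  open ≤-Reasoning
  first : ∀ x → x ∈ˢ S → m ! ≤ ∑[ s ∈ allTuples n m ] ⟦ support (x ∷ s) ≟ˢ S ⟧
  first x x∈S = ≤-trans (orderings≥ m (S ─ ⁅ x ⁆) (∣p─⁅x⁆∣ S x x∈S e))
    (∑-mono (allTuples n m) (λ {s} _ → ⟦⟧-mono (support s ≟ˢ (S ─ ⁅ x ⁆)) (support (x ∷ s) ≟ˢ S)
      (λ eq → trans (cong (⁅ x ⁆ ∪_) eq) (q∪[p─q]≡p S ⁅ x ⁆ (⁅x⁆⊆p x∈S)))))

∈-allSubsets : (S : Subset n) → S ∈ allSubsets n
∈-allSubsets []            = here refl
∈-allSubsets (outside ∷ S) = ∈-++⁺ˡ (∈-map⁺ (outside ∷_) (∈-allSubsets S))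
∈-allSubsets (inside ∷ S)  = ∈-++⁺ʳ (map (outside ∷_) (allSubsets _)) (∈-map⁺ (inside ∷_) (∈-allSubsets S))

allSubsets⁺ : (n : ℕ) → Unique (allSubsets n)
allSubsets⁺ zero    = [] ∷ []
allSubsets⁺ (suc n) = Unique.++⁺ (Unique.map⁺ Vec.∷-injectiveʳ (allSubsets⁺ n)) (Unique.map⁺ Vec.∷-injectiveʳ (allSubsets⁺ n)) disj
  where
  disj : Disjoint (map (outside ∷_) (allSubsets n)) (map (inside ∷_) (allSubsets n))
  disj (p , q) with ∈-map⁻ (outside ∷_) p | ∈-map⁻ (inside ∷_) q
  ... | _ , _ , refl | _ , _ , ()

IsEdge? : {k : ℕ} (H : KGraph n k) (T : Subset n) → Dec (edge H T ≡ true)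
IsEdge? H T = edge H T Bool.≟ true

∧-true : ∀ {a b} → a ∧ b ≡ true → a ≡ true × b ≡ true
∧-true {true} {true} _ = refl , refl

module _ {r d : ℕ} (H : KGraph n (d + r)) where

  extensions : Subset n → ℕ
  extensions S = ∑[ t ∈ allTuples n r ] ⟦ IsEdge? H (S ∪ support t) ⟧

  -- Every edge `T` above `S` is reached by the `r !` orderings of `T ─ S`, and each tuple reaches
  -- only one `T`.
  r!*deg≤extensions : (S : Subset n) → ∣ S ∣ ≡ d → r ! * deg H S ≤ extensions S
  r!*deg≤extensions S ∣S∣≡d = begin
    r ! * deg H S                               ≡⟨ cong (r ! *_) (length-filter≡∑ above? (allSubsets n)) ⟩
    r ! * ∑[ T ∈ allSubsets n ] ⟦ above? T ⟧     ≡⟨ ∑-*ˡ (r !) (allSubsets n) _ ⟨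
    ∑[ T ∈ allSubsets n ] (r ! * ⟦ above? T ⟧)   ≤⟨ ∑-mono (allSubsets n) (λ {T} _ → *⟦⟧≤ (above? T) (completions T)) ⟩
    ∑[ T ∈ allSubsets n ] ∑[ t ∈ allTuples n r ] ⟦ h? t T ⟧ ≡⟨ ∑-swap (allSubsets n) (allTuples n r) _ ⟩
    ∑[ t ∈ allTuples n r ] ∑[ T ∈ allSubsets n ] ⟦ h? t T ⟧ ≤⟨ ∑-mono (allTuples n r) (λ {t} _ → one t) ⟩
    extensions S                                ∎
    where
    open ≤-Reasoning
    above? : ∀ T → Dec ((edge H T ∧ does (S ⊆? T)) ≡ true)
    above? T = (edge H T ∧ does (S ⊆? T)) Bool.≟ true
    h? : ∀ (t : Vec (Fin n) r) T → Dec (edge H T ≡ true × S ∪ support t ≡ T)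
    h? t T = IsEdge? H T ×-dec ((S ∪ support t) ≟ˢ T)
    one : ∀ t → ∑[ T ∈ allSubsets n ] ⟦ h? t T ⟧ ≤ ⟦ IsEdge? H (S ∪ support t) ⟧
    one t with IsEdge? H (S ∪ support t)
    ... | yes _ = ∑-exclusive (h? t) (AllPairs.map (λ { T≢T′ (_ , e) (_ , e′) → T≢T′ (trans (sym e) e′) }) (allSubsets⁺ n))
    ... | no ¬edge = ≤-trans (∑-bound (allSubsets n) (λ {T} _ → none T)) (≤-reflexive (*-zeroʳ (length (allSubsets n))))
      where
      none : ∀ T → ⟦ h? t T ⟧ ≤ 0
      none T with h? t T
      ... | yes (e , eq) = contradiction (trans (cong (edge H) eq) e) ¬edge
      ... | no _ = z≤n
    completions : ∀ T → (edge H T ∧ does (S ⊆? T)) ≡ true → r ! ≤ ∑[ t ∈ allTuples n r ] ⟦ h? t T ⟧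
    completions T c with ∧-true {edge H T} c
    ... | edgeT , sub with S ⊆? T
    ... | no _ = contradiction sub (λ ())
    ... | yes S⊆T = ≤-trans
      (orderings≥ r (T ─ S) (+-cancelˡ-≡ d _ _ (trans (cong (_+ ∣ T ─ S ∣) (sym ∣S∣≡d)) (trans (sym (∣p∣≡∣q∣+∣p─q∣ T S S⊆T)) (uniform H T edgeT)))))
      (∑-mono (allTuples n r) (λ {t} _ → ⟦⟧-mono (support t ≟ˢ (T ─ S)) (h? t T)
        (λ e → edgeT , trans (cong (S ∪_) e) (q∪[p─q]≡p T S S⊆T))))

module _ {Bad : Subset n → Set} (bad? : ∀ S → Dec (Bad S)) (d : ℕ) where

  bad-tuples≤ : ∑[ s ∈ allTuples n d ] ⟦ bad? (support s) ×-dec (∣ support s ∣ ℕ.≟ d) ⟧ ≤ d ! * length (filter bad? (dSets n d))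
  bad-tuples≤ = begin
    ∑[ s ∈ allTuples n d ] ⟦ bad? (support s) ×-dec (∣ support s ∣ ℕ.≟ d) ⟧ ≤⟨ ∑-mono (allTuples n d) (λ {s} _ → found s) ⟩
    ∑[ s ∈ allTuples n d ] ∑[ S ∈ bads ] ⟦ support s ≟ˢ S ⟧ ≡⟨ ∑-swap (allTuples n d) bads _ ⟩
    ∑[ S ∈ bads ] ∑[ s ∈ allTuples n d ] ⟦ support s ≟ˢ S ⟧ ≤⟨ ∑-bound bads (λ {S} S∈ → orderings≤ d S (proj₂ (∈-filter⁻ size? {xs = allSubsets n} (proj₁ (∈-filter⁻ bad? {xs = dSets n d} S∈))))) ⟩
    length bads * d !       ≡⟨ *-comm (length bads) (d !) ⟩
    d ! * length bads       ∎
    where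
    open ≤-Reasoning
    size? : ∀ (S : Subset n) → Dec (∣ S ∣ ≡ d)
    size? S = ∣ S ∣ ℕ.≟ d
    bads = filter bad? (dSets n d)
    found : ∀ s → ⟦ bad? (support s) ×-dec (∣ support s ∣ ℕ.≟ d) ⟧ ≤ ∑[ S ∈ bads ] ⟦ support s ≟ˢ S ⟧
    found s with bad? (support s) ×-dec (∣ support s ∣ ℕ.≟ d)
    ... | no _ = z≤n
    ... | yes (b , e) = ≤-trans (≤-reflexive (sym (⟦⟧≡1 (support s ≟ˢ support s) refl)))
      (∑-member (∈-filter⁺ bad? (∈-filter⁺ size? (∈-allSubsets (support s)) e) b) (λ S → ⟦ support s ≟ˢ S ⟧))

module _ {n : ℕ} where
  open import Data.List.Relation.Unary.Unique.DecPropositional (Fin._≟_ {n}) using (unique?) public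

-- An injective tail of length `m` rules out at most `m` heads. Bounding every factor by the
-- smallest one gives a plain power.
uniqueTuples≥ : (U : List (Fin n)) → Unique U → (m : ℕ) → (length U ∸ m) ^ m ≤ ∑[ s ∈ tuples U m ] ⟦ unique? (Vec.toList s) ⟧
uniqueTuples≥ U U! zero = ≤-refl
uniqueTuples≥ U U! (suc m) = begin
  (length U ∸ suc m) * (length U ∸ suc m) ^ m ≤⟨ *-mono-≤ (∸-monoʳ-≤ (length U) (n≤1+n m)) (^-monoˡ-≤ m (∸-monoʳ-≤ (length U) (n≤1+n m))) ⟩
  (length U ∸ m) * (length U ∸ m) ^ m   ≤⟨ *-monoʳ-≤ (length U ∸ m) (uniqueTuples≥ U U! m) ⟩
  (length U ∸ m) * ∑[ s ∈ tuples U m ] ⟦ unique? (Vec.toList s) ⟧ ≡⟨ ∑-*ˡ (length U ∸ m) (tuples U m) _ ⟨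
  ∑[ s ∈ tuples U m ] ((length U ∸ m) * ⟦ unique? (Vec.toList s) ⟧) ≤⟨ ∑-mono (tuples U m) (λ {s} _ → *⟦⟧≤ (unique? (Vec.toList s)) (fresh s)) ⟩
  ∑[ s ∈ tuples U m ] ∑[ x ∈ U ] ⟦ unique? (Vec.toList (x ∷ s)) ⟧ ≡⟨ ∑-swap (tuples U m) U _ ⟩
  ∑[ x ∈ U ] ∑[ s ∈ tuples U m ] ⟦ unique? (Vec.toList (x ∷ s)) ⟧ ≡⟨ ∑-tuples U _ ⟨
  ∑[ s ∈ tuples U (suc m) ] ⟦ unique? (Vec.toList s) ⟧ ∎
  where
  open ≤-Reasoning
  fresh : ∀ s → Unique (Vec.toList s) → length U ∸ m ≤ ∑[ x ∈ U ] ⟦ unique? (Vec.toList (x ∷ s)) ⟧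
  fresh s s! = ≤-trans (m≤n+o⇒m∸n≤o (length U) m (≤-trans
      (avoid Fin._≟_ U (Vec.toList s) (λ u → AllPairs.map (λ ne e e′ → ne (trans e (sym e′))) U!))
      (≤-reflexive (trans (cong (length (filter new? U) +_) (length-toList s)) (+-comm _ m)))))
    (≤-trans (≤-reflexive (length-filter≡∑ new? U))
      (∑-mono U (λ {x} _ → ⟦⟧-mono (new? x) (unique? (Vec.toList (x ∷ s)))
        (λ new → All.tabulate (λ p e → new (Any.map (λ e′ → trans e e′) p)) ∷ s!))))
    where
    new? : ∀ x → Dec (¬ Any (x ≡_) (Vec.toList s))
    new? x = ¬? (Any.any? (x Fin.≟_) (Vec.toList s))

-- Binomial coefficients and falling factorials

nC0≡1 : ∀ n → n C 0 ≡ 1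
nC0≡1 n = trans (nCk≡nC[n∸k] {0} {n} z≤n) (nCn≡1 n)

-- The absorption identity, by induction through Pascal's rule.
[1+k]*[1+n]C[1+k] : ∀ n k → suc k * (suc n C suc k) ≡ suc n * (n C k)
[1+k]*[1+n]C[1+k] zero zero = refl
[1+k]*[1+n]C[1+k] zero (suc k) = begin
  suc (suc k) * (1 C suc (suc k)) ≡⟨ cong (suc (suc k) *_) (k>n⇒nCk≡0 {1} {suc (suc k)} (s≤s (s≤s z≤n))) ⟩
  suc (suc k) * 0                 ≡⟨ *-zeroʳ (suc (suc k)) ⟩
  0                               ≡⟨ cong (1 *_) (k>n⇒nCk≡0 {0} {suc k} (s≤s z≤n)) ⟨
  1 * (0 C suc k)                 ∎
  where open ≡-Reasoning
[1+k]*[1+n]C[1+k] (suc n) zero = begin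
  1 * (suc (suc n) C 1)         ≡⟨ cong (1 *_) (nC1≡n (suc (suc n))) ⟩
  1 * suc (suc n)               ≡⟨ *-comm 1 (suc (suc n)) ⟩
  suc (suc n) * 1               ≡⟨ cong (suc (suc n) *_) (nC0≡1 (suc n)) ⟨
  suc (suc n) * (suc n C 0)     ∎
  where open ≡-Reasoning
[1+k]*[1+n]C[1+k] (suc n) (suc k) = begin
  suc (suc k) * (suc (suc n) C suc (suc k))
    ≡⟨ cong (suc (suc k) *_) (nCk+nC[k+1]≡[n+1]C[k+1] (suc n) (suc k)) ⟨
  suc (suc k) * (suc n C suc k + suc n C suc (suc k))
    ≡⟨ split (suc k) (suc n C suc k) _ ⟩
  suc n C suc k + (suc k * (suc n C suc k) + suc (suc k) * (suc n C suc (suc k)))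
    ≡⟨ cong (suc n C suc k +_) (cong₂ _+_ ([1+k]*[1+n]C[1+k] n k) ([1+k]*[1+n]C[1+k] n (suc k))) ⟩
  suc n C suc k + (suc n * (n C k) + suc n * (n C suc k))
    ≡⟨ cong (suc n C suc k +_) (trans (sym (*-distribˡ-+ (suc n) (n C k) _)) (cong (suc n *_) (nCk+nC[k+1]≡[n+1]C[k+1] n k))) ⟩
  suc (suc n) * (suc n C suc k) ∎
  where
  open ≡-Reasoning
  split : ∀ k a b → suc k * (a + b) ≡ a + (k * a + suc k * b)
  split = solve-∀

-- `m ! * (n C m)` is the falling factorial n (n-1) ... (n-m+1). This is its recursion, from which
-- the bounds `n ^ m` and `(n ∸ m) ^ m` follow factor by factor.
m!*nCm-step : ∀ n m → suc m ! * (suc n C suc m) ≡ suc n * (m ! * (n C m))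
m!*nCm-step n m = begin
  suc m * m ! * (suc n C suc m)    ≡⟨ left (suc m) (m !) _ ⟩
  m ! * (suc m * (suc n C suc m))  ≡⟨ cong (m ! *_) ([1+k]*[1+n]C[1+k] n m) ⟩
  m ! * (suc n * (n C m))          ≡⟨ right (m !) (suc n) _ ⟩
  suc n * (m ! * (n C m))          ∎
  where
  open ≡-Reasoning
  left : ∀ a b c → a * b * c ≡ b * (a * c)
  left = solve-∀
  right : ∀ a b c → a * (b * c) ≡ b * (a * c)
  right = solve-∀

m!*nCm≤n^m : ∀ n m → m ! * (n C m) ≤ n ^ m
m!*nCm≤n^m n zero = ≤-reflexive (trans (+-identityʳ _) (nC0≡1 n))
m!*nCm≤n^m zero (suc m) = ≤-reflexive (trans (cong (suc m ! *_) (k>n⇒nCk≡0 {0} {suc m} (s≤s z≤n))) (*-zeroʳ (suc m !)))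
m!*nCm≤n^m (suc n) (suc m) = ≤-trans (≤-reflexive (m!*nCm-step n m))
  (*-monoʳ-≤ (suc n) (≤-trans (m!*nCm≤n^m n m) (^-monoˡ-≤ m (n≤1+n n))))

[n∸m]^m≤m!*nCm : ∀ n m → (n ∸ m) ^ m ≤ m ! * (n C m)
[n∸m]^m≤m!*nCm n zero = ≤-reflexive (sym (trans (+-identityʳ _) (nC0≡1 n)))
[n∸m]^m≤m!*nCm zero (suc m) = z≤n
[n∸m]^m≤m!*nCm (suc n) (suc m) = ≤-trans (*-mono-≤ (≤-trans (m∸n≤m n m) (n≤1+n n)) ([n∸m]^m≤m!*nCm n m))
  (≤-reflexive (sym (m!*nCm-step n m)))

-- Powers and blocks

^-distribʳ-* : ∀ r m n → (m * n) ^ r ≡ m ^ r * n ^ r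
^-distribʳ-* zero    m n = refl
^-distribʳ-* (suc r) m n = trans (cong (m * n *_) (^-distribʳ-* r m n)) (interchange m n (m ^ r) (n ^ r))
  where
  interchange : ∀ a b c d → a * b * (c * d) ≡ a * c * (b * d)
  interchange = solve-∀

-- The mean value bound s^m - x^m ≤ a m s^(m-1) for s = x + a, multiplied by s so that the exponent
-- m - 1 does not appear.
power-step : ∀ x a m → (x + a) * (x + a) ^ m ≤ (x + a) * x ^ m + a * m * (x + a) ^ m
power-step x a zero = m≤m+n _ _
power-step x a (suc m) = begin
  s * (s * s ^ m)                       ≤⟨ *-monoʳ-≤ s (power-step x a m) ⟩
  s * (s * x ^ m + a * m * s ^ m)       ≡⟨ split x a (x ^ m) m (s ^ m) ⟩
  s * (x * x ^ m) + (a * (s * x ^ m) + a * m * (s * s ^ m)) ≤⟨ +-monoʳ-≤ (s * (x * x ^ m)) (+-monoˡ-≤ _ (*-monoʳ-≤ a (*-monoʳ-≤ s (^-monoˡ-≤ m (m≤m+n x a))))) ⟩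
  s * (x * x ^ m) + (a * (s * s ^ m) + a * m * (s * s ^ m)) ≡⟨ cong (s * (x * x ^ m) +_) (join a m (s * s ^ m)) ⟩
  s * x ^ suc m + a * suc m * s ^ suc m ∎
  where
  open ≤-Reasoning
  s = x + a
  split : ∀ x a p m q → (x + a) * ((x + a) * p + a * m * q) ≡ (x + a) * (x * p) + (a * ((x + a) * p) + a * m * ((x + a) * q))
  split = solve-∀
  join : ∀ a m z → a * z + a * m * z ≡ a * suc m * z
  join = solve-∀

-- By `power-step`, the relative error of replacing `x + a` by `x` in an `m`-th power is at most a m
-- / (x + a), here at most 1 / (κ + 1).
power-close : ∀ κ x a m → 0 < x + a → a * m * suc κ ≤ x + a → κ * (x + a) ^ m ≤ suc κ * x ^ m
power-close κ x a m s>0 large = *-cancelˡ-≤ (x + a) {{>-nonZero s>0}} (+-cancelʳ-≤ (s * s ^ m) _ _ (begin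
  s * (κ * s ^ m) + s * s ^ m            ≡⟨ e₁ s κ (s ^ m) ⟩
  suc κ * (s * s ^ m)                    ≤⟨ *-monoʳ-≤ (suc κ) (power-step x a m) ⟩
  suc κ * (s * x ^ m + a * m * s ^ m)    ≡⟨ e₂ κ s (x ^ m) (a * m) (s ^ m) ⟩
  s * (suc κ * x ^ m) + a * m * suc κ * s ^ m ≤⟨ +-monoʳ-≤ (s * (suc κ * x ^ m)) (*-monoˡ-≤ (s ^ m) large) ⟩
  s * (suc κ * x ^ m) + s * s ^ m        ∎))
  where
  open ≤-Reasoning
  s = x + a
  e₁ : ∀ s κ p → s * (κ * p) + s * p ≡ suc κ * (s * p)
  e₁ = solve-∀
  e₂ : ∀ κ s p b q → suc κ * (s * p + b * q) ≡ s * (suc κ * p) + b * suc κ * q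
  e₂ = solve-∀

-- The error terms c − b and b − a are at most b / κ, and κ = α + q Z leaves
-- room for them in α − (q t′ + 1).
absorb-errors : ∀ q t′ Z a b c E S → let α = q * t′ + Z; κ = α + q * Z in
  2 ≤ Z → a ≤ b → κ * c ≤ suc κ * b → κ * b ≤ suc κ * a →
  α * a ≤ q * E → E + Z * b ≤ Z * c + S →
  (q * t′ + 1) * b ≤ q * S
absorb-errors q t′ Z a b c E S 2≤Z a≤b c-close a-close ext block =
  +-cancelʳ-≤ (q * Z * c) _ _ (begin
    (q * t′ + 1) * b + q * Z * c   ≤⟨ *-cancelˡ-≤ κ {{>-nonZero κ>0}} (+-cancelʳ-≤ (α * a) _ _ scaled) ⟩
    α * a + q * Z * b              ≤⟨ +-monoˡ-≤ _ ext ⟩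
    q * E + q * Z * b              ≡⟨ e₁ q E Z b ⟩
    q * (E + Z * b)                ≤⟨ *-monoʳ-≤ q block ⟩
    q * (Z * c + S)                ≡⟨ e₂ q Z c S ⟩
    q * S + q * Z * c              ∎)
  where
  open ≤-Reasoning
  α = q * t′ + Z
  κ = α + q * Z
  κ>0 : 0 < κ
  κ>0 = ≤-trans (<⇒≤ 2≤Z) (≤-trans (m≤n+m Z (q * t′)) (m≤m+n α (q * Z)))
  e₁ : ∀ q E Z b → q * E + q * Z * b ≡ q * (E + Z * b)
  e₁ = solve-∀
  e₂ : ∀ q Z c S → q * (Z * c + S) ≡ q * S + q * Z * c
  e₂ = solve-∀
  e₃ : ∀ κ p b z c → κ * (p * b + z * c) ≡ κ * p * b + z * (κ * c)
  e₃ = solve-∀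
  e₄ : ∀ α z p b → (α + z) * (p + 1) * b + z * (suc (α + z) * b) + α * b ≡ (α + z) * (p + 2) * b + (α + z) * z * b
  e₄ = solve-∀
  e₅ : ∀ α κ z b → κ * α * b + κ * z * b ≡ α * (κ * b) + κ * z * b
  e₅ = solve-∀
  e₆ : ∀ α κ z a b → α * (suc κ * a) + κ * z * b ≡ κ * (α * a + z * b) + α * a
  e₆ = solve-∀
  -- The errors `q * Z * b` (from `c`) and `α * a` (from `a`) sum to at most `κ * b`, which is why
  -- `κ` is `α + q * Z`. They turn `q * t′ + 1` into `q * t′ + 2`, and `2 ≤ Z` covers that.
  scaled : κ * ((q * t′ + 1) * b + q * Z * c) + α * a ≤ κ * (α * a + q * Z * b) + α * a
  scaled = begin
    κ * ((q * t′ + 1) * b + q * Z * c) + α * a       ≡⟨ cong (_+ α * a) (e₃ κ (q * t′ + 1) b (q * Z) c) ⟩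
    κ * (q * t′ + 1) * b + q * Z * (κ * c) + α * a   ≤⟨ +-mono-≤ (+-monoʳ-≤ (κ * (q * t′ + 1) * b) (*-monoʳ-≤ (q * Z) c-close)) (*-monoʳ-≤ α a≤b) ⟩
    κ * (q * t′ + 1) * b + q * Z * (suc κ * b) + α * b ≡⟨ e₄ α (q * Z) (q * t′) b ⟩
    κ * (q * t′ + 2) * b + κ * (q * Z) * b           ≤⟨ +-monoˡ-≤ _ (*-monoˡ-≤ b (*-monoʳ-≤ κ (+-monoʳ-≤ (q * t′) 2≤Z))) ⟩
    κ * α * b + κ * (q * Z) * b                      ≡⟨ e₅ α κ (q * Z) b ⟩
    α * (κ * b) + κ * (q * Z) * b                    ≤⟨ +-monoˡ-≤ _ (*-monoʳ-≤ α a-close) ⟩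
    α * (suc κ * a) + κ * (q * Z) * b                ≡⟨ e₆ α κ (q * Z) a b ⟩
    κ * (α * a + q * Z * b) + α * a                  ∎

∑-allFin-suc : (f : Fin (suc n) → ℕ) → ∑ (allFin (suc n)) f ≡ f zero + ∑ (allFin n) (f ∘ suc)
∑-allFin-suc {n} f = cong (f zero +_) (trans (cong (λ xs → ∑ xs f) (sym (map-tabulate (λ i → i) (suc {n})))) (∑-map suc (allFin n) f))

∑-toList : (v : Vec A m) (f : A → ℕ) → ∑ (Vec.toList v) f ≡ ∑[ i ∈ allFin m ] f (lookup v i)
∑-toList []      f = refl
∑-toList (x ∷ v) f = trans (cong (f x +_) (∑-toList v f)) (sym (∑-allFin-suc (f ∘ lookup (x ∷ v))))

pick : {k : ℕ} → Vec (Vec A k) m → Vec (Fin k) m → Vec A m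
pick = zipWith lookup

vertices : {k : ℕ} → List (Vec A k) → List A
vertices = concatMap Vec.toList

length-vertices : {k : ℕ} (Bs : List (Vec A k)) → length (vertices Bs) ≡ length Bs * k
length-vertices {k = k} Bs = begin
  length (vertices Bs)                       ≡⟨ length≡∑ (vertices Bs) ⟩
  ∑ (vertices Bs) (λ _ → 1)                  ≡⟨ ∑-concatMap Vec.toList Bs _ ⟩
  ∑[ B ∈ Bs ] ∑ (Vec.toList B) (λ _ → 1)     ≡⟨ ∑-cong Bs (λ B → trans (sym (length≡∑ (Vec.toList B))) (length-toList B)) ⟩
  ∑[ B ∈ Bs ] k                              ≡⟨ ∑-const Bs k ⟩
  length Bs * k                              ∎
  where open ≡-Reasoning

∑-vertices : {k : ℕ} (Bs : List (Vec A k)) (f : A → ℕ) → ∑ (vertices Bs) f ≡ ∑[ B ∈ Bs ] ∑[ i ∈ allFin k ] f (lookup B i)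
∑-vertices Bs f = trans (∑-concatMap Vec.toList Bs f) (∑-cong Bs (λ B → ∑-toList B f))

-- Converts a count of vertex tuples into a count of positions for each block tuple, the form in
-- which the positions can be compared across block tuples by pigeonhole.
∑-blocks : {k : ℕ} (Bs : List (Vec A k)) (m : ℕ) (f : Vec A m → ℕ) →
  ∑ (tuples (vertices Bs) m) f ≡ ∑[ b ∈ tuples Bs m ] ∑[ x ∈ allTuples k m ] f (pick b x)
∑-blocks Bs zero f = sym (+-identityʳ _)
∑-blocks {k = k} Bs (suc m) f = begin
  ∑ (tuples (vertices Bs) (suc m)) f                             ≡⟨ ∑-tuples (vertices Bs) f ⟩
  ∑[ v ∈ vertices Bs ] ∑[ w ∈ tuples (vertices Bs) m ] f (v ∷ w) ≡⟨ ∑-vertices Bs _ ⟩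
  ∑[ B ∈ Bs ] ∑[ i ∈ allFin k ] ∑[ w ∈ tuples (vertices Bs) m ] f (lookup B i ∷ w)
    ≡⟨ ∑-cong Bs (λ B → ∑-cong (allFin k) (λ i → ∑-blocks Bs m (λ w → f (lookup B i ∷ w)))) ⟩
  ∑[ B ∈ Bs ] ∑[ i ∈ allFin k ] ∑[ b ∈ tuples Bs m ] ∑[ x ∈ allTuples k m ] f (lookup B i ∷ pick b x)
    ≡⟨ ∑-cong Bs (λ B → ∑-swap (allFin k) (tuples Bs m) _) ⟩
  ∑[ B ∈ Bs ] ∑[ b ∈ tuples Bs m ] ∑[ i ∈ allFin k ] ∑[ x ∈ allTuples k m ] f (lookup B i ∷ pick b x)
    ≡⟨ ∑-cong Bs (λ B → ∑-cong (tuples Bs m) (λ b → ∑-tuples (allFin k) (λ x → f (pick (B ∷ b) x)))) ⟨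
  ∑[ B ∈ Bs ] ∑[ b ∈ tuples Bs m ] ∑[ x ∈ allTuples k (suc m) ] f (pick (B ∷ b) x)
    ≡⟨ ∑-tuples Bs _ ⟨
  ∑[ b ∈ tuples Bs (suc m) ] ∑[ x ∈ allTuples k (suc m) ] f (pick b x) ∎
  where open ≡-Reasoning

-- Complementary counting: the tuples outside W are at most n ^ m − ∣ W ∣ ^ m.
∑-outside : {P : Vec (Fin n) m → Set} (P? : ∀ v → Dec (P v)) (W : List (Fin n)) → Unique W →
  ∑[ v ∈ allTuples n m ] ⟦ P? v ⟧ + length W ^ m ≤ n ^ m + ∑[ v ∈ tuples W m ] ⟦ P? v ⟧
∑-outside {n} {m} P? W W! = begin
  ∑ V yes# + length W ^ m                ≡⟨ cong (∑ V yes# +_) (trans (sym (length-tuples W m)) (total (tuples W m))) ⟩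
  ∑ V yes# + (∑ (tuples W m) yes# + ∑ (tuples W m) no#) ≤⟨ +-monoʳ-≤ (∑ V yes#) (+-monoʳ-≤ _ (tuples-⊆ W! (λ {x} _ → ∈-allFin x) no#)) ⟩
  ∑ V yes# + (∑ (tuples W m) yes# + ∑ V no#) ≡⟨ rearrange (∑ V yes#) _ _ ⟩
  ∑ V yes# + ∑ V no# + ∑ (tuples W m) yes#  ≡⟨ cong (_+ ∑ (tuples W m) yes#) (trans (sym (total V)) (length-allTuples n m)) ⟩
  n ^ m + ∑ (tuples W m) yes#              ∎
  where
  open ≤-Reasoning
  V = allTuples n m
  yes# no# : Vec (Fin n) m → ℕ
  yes# v = ⟦ P? v ⟧
  no# v = ⟦ ¬? (P? v) ⟧
  one : ∀ v → 1 ≡ yes# v + no# v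
  one v with P? v
  ... | yes _ = refl
  ... | no _  = refl
  total : ∀ xs → length xs ≡ ∑ xs yes# + ∑ xs no#
  total xs = trans (length≡∑ xs) (trans (∑-cong xs one) (∑-+ xs yes# no#))
  rearrange : ∀ a b c → a + (b + c) ≡ a + c + b
  rearrange = solve-∀

split-off : (k : ℕ) (xs : List A) → k ≤ length xs → Σ (Vec A k) λ v → Σ (List A) λ ys → Vec.toList v ++ ys ≡ xs
split-off zero    xs       _       = [] , xs , refl
split-off (suc k) (x ∷ xs) (s≤s h) = let v , ys , e = split-off k xs h in x ∷ v , ys , cong (x ∷_) e

chop : (k : ℕ) .{{_ : NonZero k}} (fuel : ℕ) (xs : List A) → length xs ≤ fuel →
  Σ (List (Vec A k)) λ Bs → Σ (List A) λ rest → vertices Bs ++ rest ≡ xs × length rest < k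
chop (suc k) zero [] z≤n = [] , [] , refl , s≤s z≤n
chop k (suc fuel) xs h with k ≤? length xs
... | no short = [] , xs , refl , ≰⇒> short
... | yes long with split-off k xs long
... | v , ys , refl with chop k fuel ys (≤-pred (≤-trans (shorter (length ys) k) (subst (_≤ suc fuel) (trans (length-++ (Vec.toList v)) (cong (_+ length ys) (length-toList v))) h)))
  where
  shorter : ∀ l k .{{_ : NonZero k}} → suc l ≤ k + l
  shorter l (suc k) = s≤s (m≤n+m l k)
... | Bs , rest , e , short = v ∷ Bs , rest , trans (++-assoc (Vec.toList v) (vertices Bs) rest) (cong (Vec.toList v ++_) e) , short

Unique-++⁻ : (xs : List A) {ys : List A} → Unique (xs ++ ys) → Unique xs × Unique ys × Disjoint xs ys
Unique-++⁻ []       u = [] , u , λ ()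
Unique-++⁻ (x ∷ xs) (px ∷ u) = let xs! , ys! , disj = Unique-++⁻ xs u in
  ++⁻ˡ xs px ∷ xs! , ys! , λ { (here refl , q) → All.lookup (++⁻ʳ xs px) q refl ; (there p , q) → disj (p , q) }

blocks⁻ : {k : ℕ} (Bs : List (Vec A k)) {rest : List A} → Unique (vertices Bs ++ rest) →
  All (Unique ∘ Vec.toList) Bs × AllPairs (λ B B′ → Disjoint (Vec.toList B) (Vec.toList B′)) Bs
blocks⁻ [] u = [] , []
blocks⁻ (B ∷ Bs) {rest} u with Unique-++⁻ (Vec.toList B) (subst Unique (++-assoc (Vec.toList B) (vertices Bs) rest) u)
... | B! , rest! , disj = let Bs! , pairs = blocks⁻ Bs rest! in
  B! ∷ Bs! , All.tabulate (λ B′∈ (p , q) → disj (p , ∈-++⁺ˡ (∈-concatMap⁺ Vec.toList (Any.map (λ { refl → q }) B′∈)))) ∷ pairs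

-- Exchanging blocks for edges

∈-lookup⁻ : {A : Set} {m : ℕ} {x : A} (v : Vec A m) → x ∈ Vec.toList v → ∃[ j ] lookup v j ≡ x
∈-lookup⁻ (y ∷ v) (here refl) = zero , refl
∈-lookup⁻ (y ∷ v) (there p)   = let j , e = ∈-lookup⁻ v p in suc j , e

∈-lookup⁺ : {A : Set} {m : ℕ} (v : Vec A m) (j : Fin m) → lookup v j ∈ Vec.toList v
∈-lookup⁺ (x ∷ v) zero    = here refl
∈-lookup⁺ (x ∷ v) (suc j) = there (∈-lookup⁺ v j)

Unique⇒lookup-injective : {A : Set} {m : ℕ} (v : Vec A m) → Unique (Vec.toList v) → ∀ i j → lookup v i ≡ lookup v j → i ≡ j
Unique⇒lookup-injective (x ∷ v) (px ∷ u) zero    zero    e = refl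
Unique⇒lookup-injective (x ∷ v) (px ∷ u) zero    (suc j) e = contradiction e (All.lookup px (∈-lookup⁺ v j))
Unique⇒lookup-injective (x ∷ v) (px ∷ u) (suc i) zero    e = contradiction (sym e) (All.lookup px (∈-lookup⁺ v i))
Unique⇒lookup-injective (x ∷ v) (px ∷ u) (suc i) (suc j) e = cong suc (Unique⇒lookup-injective v u i j e)

module Blocks (n k : ℕ) = Boxes {Fin n} {Vec (Fin n) k} Fin._≟_ Vec.toList
module Points (n : ℕ) = Boxes {Fin n} {Fin n} Fin._≟_ (λ v → v ∷ [])

module _ {n k : ℕ} (H : KGraph n k) where
  open Blocks n k using (_#_; #-sym)

  record Matching (M : List (Vec (Fin n) k)) : Set where
    field
      edges    : All (λ B → edge H (support B) ≡ true) M
      disjoint : AllPairs _#_ M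

  edge⇒Unique : (B : Vec (Fin n) k) → edge H (support B) ≡ true → Unique (Vec.toList B)
  edge⇒Unique B e = ∣support∣⇒Unique B (uniform H _ e)

module Replacement {n d r₀ : ℕ} (H : KGraph n (suc d + (2 + r₀))) where
  private
    r = 2 + r₀
    k = suc d + r
  open Blocks n k using (_#_; #-sym; share⇒≡)

  _≟ᴮ_ : DecidableEquality (Vec (Fin n) k)
  _≟ᴮ_ = Vec.≡-dec Fin._≟_

  -- At most `length used` edges of `M` are given up, since each block met equals at most one of
  -- them and the auxiliary blocks equal none that matter; `L` edges are gained, and `few-used`
  -- compares the two.
  replace : ∀ {t g} (M Bs : List (Vec (Fin n) k)) (U : List (Fin n)) → Matching H M →
    (∀ {B} → B ∈ M → B ∈ Bs) → AllPairs _#_ Bs → All (Unique ∘ Vec.toList) Bs →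
    (∀ {B v} → B ∈ M → v ∈ Vec.toList B → v ∉ U) →
    (S : Fin (suc d) → Fin t → Fin n) → (∀ j i → S j i ∈ U) → (∀ j i j′ i′ → S j i ≡ S j′ i′ → i ≡ i′) →
    (P : Fin r → Fin t → Vec (Fin n) k) → (∀ j i → P j i ∈ Bs) →
    (∀ j i j′ i′ {v} → v ∈ Vec.toList (P j i) → v ∈ Vec.toList (P j′ i′) → j ≡ j′ × i ≡ i′) →
    (∀ j i j′ i′ → S j i ∉ Vec.toList (P j′ i′)) →
    (bm : BlowUpMatching k r t g) →
    (∀ i (c : Fin r → Fin t) {x} → x ∈ g →
      edge H (support (tabulate (λ j → S j i)) ∪ support (pick (tabulate (λ j → P j (c j))) x)) ≡ true) →
    ∃[ M′ ] Matching H M′ × length M < length M′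
  replace {t} M Bs U matching M⊆Bs Bs# Bs! M∩U S S∈U S-sep P P∈Bs P-sep S∉P bm isEdge =
    kept ++ new ,
    record
      { edges    = All.tabulate λ B∈ → [ (λ B∈kept → All.lookup (Matching.edges matching) (kept⊆M B∈kept))
                                       , (λ B∈new → new-edge B∈new) ]′ (∈-++⁻ kept B∈)
      ; disjoint = AllPairs.++⁺ (AllPairs.filter⁺ _ (Matching.disjoint matching)) (AllPairs.tabulate⁺ new-disjoint)
                     (All.tabulate (λ B∈kept → All.tabulate (λ {B′} B′∈new → kept#new B∈kept B′∈new)))
      } ,
    bigger
    where
    open BlowUpMatching bm
    import Data.List.Relation.Unary.AllPairs.Properties as AllPairs

    removed : List (Vec (Fin n) k)
    removed = map (λ (j , i) → P j i) used
    removed? : ∀ B → Dec (Any (B ≡_) removed)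
    removed? B = Any.any? (B ≟ᴮ_) removed
    kept : List (Vec (Fin n) k)
    kept = filter (λ B → ¬? (removed? B)) M
    kept⊆M : ∀ {B} → B ∈ kept → B ∈ M
    kept⊆M B∈ = proj₁ (∈-filter⁻ (λ B → ¬? (removed? B)) {xs = M} B∈)

    -- New edge `i` takes the `i`-th vertex of every pool in `U`, so edges with different indices
    -- share none of these; `L≤t` supplies enough indices.
    sPart : Fin L → Vec (Fin n) (suc d)
    sPart i = tabulate (λ j → S j (inject≤ i L≤t))
    bPart : Fin L → Vec (Fin n) r
    bPart i = pick (tabulate (λ j → P j (copyOf i j))) (word i)
    newEdge : Fin L → Vec (Fin n) k
    newEdge i = sPart i Vec.++ bPart i
    new : List (Vec (Fin n) k)
    new = List.tabulate newEdge

    isEdge-new : ∀ i → edge H (support (newEdge i)) ≡ true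
    isEdge-new i = trans (cong (edge H) (support-++ (sPart i) (bPart i))) (isEdge (inject≤ i L≤t) (copyOf i) (word∈ i))

    new-edge : ∀ {B} → B ∈ new → edge H (support B) ≡ true
    new-edge B∈ with ∈-tabulate⁻ B∈
    ... | i , refl = isEdge-new i

    data Origin (i : Fin L) (v : Fin n) : Set where
      fromS : ∀ j → v ≡ S j (inject≤ i L≤t) → Origin i v
      fromP : ∀ j → v ≡ lookup (P j (copyOf i j)) (lookup (word i) j) → Origin i v

    origin : ∀ i {v} → v ∈ Vec.toList (newEdge i) → Origin i v
    origin i {v} v∈ with ∈-++⁻ (Vec.toList (sPart i)) (subst (v ∈_) (toList-++ (sPart i) (bPart i)) v∈)
    ... | inj₁ p = let j , e = ∈-lookup⁻ (sPart i) p in fromS j (trans (sym e) (lookup∘tabulate (λ j → S j (inject≤ i L≤t)) j))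
    ... | inj₂ p = let j , e = ∈-lookup⁻ (bPart i) p in fromP j (trans (sym e) (trans
                     (lookup-zipWith lookup j (tabulate (λ j → P j (copyOf i j))) (word i))
                     (cong (λ B → lookup B (lookup (word i) j)) (lookup∘tabulate (λ j → P j (copyOf i j)) j))))

    fromP∈ : ∀ {i j v} → v ≡ lookup (P j (copyOf i j)) (lookup (word i) j) → v ∈ Vec.toList (P j (copyOf i j))
    fromP∈ {i} {j} refl = ∈-lookup⁺ (P j (copyOf i j)) (lookup (word i) j)

    new-disjoint : ∀ {i i′} → i ≢ i′ → newEdge i # newEdge i′
    new-disjoint {i} {i′} i≢i′ (p , q) with origin i p | origin i′ q
    ... | fromS j e | fromS j′ e′ = i≢i′ (Fin.inject≤-injective L≤t L≤t i i′ (S-sep _ _ _ _ (trans (sym e) e′)))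
    ... | fromS j e | fromP j′ e′ = S∉P _ _ _ _ (subst (_∈ _) e (fromP∈ e′))
    ... | fromP j e | fromS j′ e′ = S∉P _ _ _ _ (subst (_∈ _) e′ (fromP∈ e))
    ... | fromP j e | fromP j′ e′ with P-sep _ _ _ _ (fromP∈ e) (fromP∈ e′)
    ... | refl , c≡ = i≢i′ (distinct i i′ j c≡ (Unique⇒lookup-injective (P j (copyOf i j)) (All.lookup Bs! (P∈Bs j (copyOf i j))) _ _
                        (trans (trans (sym e) e′) (cong (λ c → lookup (P j c) (lookup (word i′) j)) (sym c≡)))))

    kept#new : ∀ {B B′} → B ∈ kept → B′ ∈ new → B # B′
    kept#new B∈ B′∈ (p , q) with ∈-tabulate⁻ B′∈
    ... | i , refl with origin i q
    ... | fromS j e = M∩U (kept⊆M B∈) p (subst (_∈ U) (sym e) (S∈U j (inject≤ i L≤t)))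
    -- As the blocks are pairwise disjoint, a shared vertex identifies the kept edge with a block
    -- that was removed.
    ... | fromP j e = proj₂ (∈-filter⁻ (λ B → ¬? (removed? B)) {xs = M} B∈)
      (subst (λ B → Any (B ≡_) removed) (share⇒≡ _≟ᴮ_ Bs# (P∈Bs j (copyOf i j)) (M⊆Bs (kept⊆M B∈)) (fromP∈ e) p)
        (∈-map⁺ (λ (j , i) → P j i) (copyOf∈ i j)))

    M-distinct : AllPairs _≢_ M
    M-distinct = AllPairs.map (λ { {B} {B′} B#B′ refl → B#B′ (∈-lookup⁺ B zero , ∈-lookup⁺ B zero) }) (Matching.disjoint matching)

    bigger : length M < length (kept ++ new)
    bigger = begin-strict
      length M                       ≤⟨ avoid _≟ᴮ_ M removed (λ _ → AllPairs.map (λ ne e e′ → ne (trans e (sym e′))) M-distinct) ⟩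
      length kept + length removed   ≡⟨ cong (length kept +_) (length-map _ used) ⟩
      length kept + length used      <⟨ +-monoʳ-< (length kept) few-used ⟩
      length kept + L                ≡⟨ cong (length kept +_) (length-tabulate newEdge) ⟨
      length kept + length new       ≡⟨ length-++ kept ⟨
      length (kept ++ new)           ∎
      where open ≤-Reasoning

-- The augmentation step

∈-⋃⁺ : ∀ {n k} (M : List (Vec (Fin n) k)) {B v} → B ∈ M → v ∈ Vec.toList B → v ∈ˢ ⋃ (map support M)
∈-⋃⁺ (B ∷ M) (here refl) v∈ = x∈p∪q⁺ (inj₁ (∈-support⁺ B v∈))
∈-⋃⁺ (B ∷ M) (there p)   v∈ = x∈p∪q⁺ (inj₂ (∈-⋃⁺ M p v∈))

∈-⋃⁻ : ∀ {n k} (M : List (Vec (Fin n) k)) {v} → v ∈ˢ ⋃ (map support M) → v ∈ vertices M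
∈-⋃⁻ []      v∈ = ⊥-elim (∉⊥ v∈)
∈-⋃⁻ (B ∷ M) v∈ with x∈p∪q⁻ (support B) _ v∈
... | inj₁ p = ∈-++⁺ˡ (∈-support⁻ B p)
... | inj₂ p = ∈-++⁺ʳ (Vec.toList B) (∈-⋃⁻ M p)

leftover : ∀ {n k} → List (Vec (Fin n) k) → List (Fin n)
leftover M = elements (∁ (⋃ (map support M)))

boxDensity>0 : ∀ t′ m D → 0 < D → 0 < boxDensity t′ m D
boxDensity>0 t′ zero    D D>0 = D>0
boxDensity>0 t′ (suc m) D D>0 = boxDensity>0 t′ m (stepDensity t′ D) (stepDensity>0 t′ D D>0)

-- `Z` counts position tuples and is also the number `suc t₀` of copies in the blow-up; `suc t′` is
-- the size demanded of `g`. `density₁` is the pigeonhole loss, doubled since half of the d-tuples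
-- are good, and `density₂` is what remains after the box in the uncovered set. `size₁` bounds the
-- uncovered set from below and `size₂` the number of blocks; `size₁≥d` and `size₂≥r` are the
-- hypotheses of `power-close`. The blocks have to avoid the `d * suc t₀` vertices of the first box.
record Parameters (d₀ r₀ q : ℕ) : Set where
  private
    d = suc d₀
    r = 2 + r₀
    k = d + r
  field
    Z t′ t₀ density₁ density₂ size₁ size₂ : ℕ
    q>0       : 0 < q
    Z≡        : Z ≡ k ^ r
    t′≡       : suc t′ ≡ r * k ^ suc r₀
    t₀≡       : suc t₀ ≡ Z
    density₁≡ : density₁ ≡ 2 * (q * Z * 2 ^ Z)
    density₂≡ : density₂ ≡ boxDensity t₀ d density₁
    size₁≥box : boxSize t₀ 1 d density₁ 0 ≤ size₁
    size₁≥d   : d + d * d * 4 ≤ size₁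
    size₂≥box : boxSize t₀ k r density₂ (d * suc t₀) ≤ size₂
    size₂≥r   : r * suc (q * t′ + Z + q * Z) < size₂

parameters : ∀ d₀ r₀ q → 0 < q → Parameters d₀ r₀ q
parameters d₀ r₀ q q>0 = record
  { Z = Z ; t′ = t′ ; t₀ = pred Z ; density₁ = density₁ ; density₂ = density₂
  ; size₁ = boxSize (pred Z) 1 d density₁ 0 + (d + d * d * 4)
  ; size₂ = boxSize (pred Z) k r density₂ (d * suc (pred Z)) + suc (r * suc (q * t′ + Z + q * Z))
  ; q>0 = q>0
  ; Z≡ = refl
  ; t′≡ = suc-pred (r * k ^ suc r₀) {{>-nonZero (*-pos {r} (s≤s z≤n) (m^n>0 k (suc r₀)))}}
  ; t₀≡ = suc-pred Z {{>-nonZero (m^n>0 k r)}}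
  ; density₁≡ = refl
  ; density₂≡ = refl
  ; size₁≥box = m≤m+n _ _
  ; size₁≥d = m≤n+m _ _
  ; size₂≥box = m≤m+n _ _
  ; size₂≥r = m≤n+m _ _
  }
  where
  d = suc d₀
  r = 2 + r₀
  k = d + r
  Z = k ^ r
  t′ = pred (r * k ^ suc r₀)
  density₁ = 2 * (q * Z * 2 ^ Z)
  density₂ = boxDensity (pred Z) d density₁

module Augmentation (d₀ r₀ q : ℕ) (params : Parameters d₀ r₀ q) where

  open Parameters params

  d r k κ : ℕ
  d = suc d₀
  r = 2 + r₀
  k = d + r
  κ = q * t′ + Z + q * Z

  Z>0 : 0 < Z
  Z>0 = subst (0 <_) t₀≡ (s≤s z≤n)

  2≤Z : 2 ≤ Z
  2≤Z = subst (2 ≤_) (sym Z≡) (≤-trans (≤-trans (s≤s (s≤s z≤n)) (m≤n+m r d)) (m≤m*n k (k ^ suc r₀) {{>-nonZero (m^n>0 k (suc r₀))}}))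

  [k*m]^r : ∀ m → (k * m) ^ r ≡ Z * m ^ r
  [k*m]^r m = trans (^-distribʳ-* r k m) (cong (_* m ^ r) (sym Z≡))

  density₁>0 : 0 < density₁
  density₁>0 = subst (0 <_) (sym density₁≡) (*-pos {2} (s≤s z≤n) (*-pos (*-pos q>0 Z>0) (m^n>0 2 Z)))

  density₂>0 : 0 < density₂
  density₂>0 = subst (0 <_) (sym density₂≡) (boxDensity>0 t₀ d density₁ density₁>0)

  module _ {n : ℕ} (H : KGraph n k) {Bad : Subset n → Set} (bad? : ∀ S → Dec (Bad S))
    -- Cleared of denominators: deg S is at least (t′ / Z + 1 / q) times the binomial coefficient.
    (large-degree : ∀ S → ∣ S ∣ ≡ d → ¬ Bad S → (q * t′ + Z) * ((n ∸ d) C r) ≤ q * Z * deg H S)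
    (M : List (Vec (Fin n) k)) (matching : Matching H M) where

    private
      open Blocks n k using (_#_)
      module Sep = Points n
      module BlockBoxes = Blocks n k

      U : List (Fin n)
      U = leftover M
      u : ℕ
      u = length U

      U! : Unique U
      U! = elements⁺ (∁ (⋃ (map support M)))

      M∩U : ∀ {B v} → B ∈ M → v ∈ Vec.toList B → v ∉ U
      M∩U B∈ v∈ v∈U = x∈∁p⇒x∉p (∈-elements⁻ v∈U) (∈-⋃⁺ M B∈ v∈)

    module _ (u-large : size₁ ≤ u) (n-large : k * suc size₂ ≤ n) (few-bad : 8 * (d ! * length (filter bad? (dSets n d))) ≤ u ^ d)
      (F : List (Vec (Fin n) k)) (rest : List (Fin n)) (F++rest≡U : vertices F ++ rest ≡ U) (short : length rest < k) where

      open ≤-Reasoning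

      F⊆U : ∀ {B v} → B ∈ F → v ∈ Vec.toList B → v ∈ U
      F⊆U B∈ v∈ = subst (_ ∈_) F++rest≡U (∈-++⁺ˡ (∈-concatMap⁺ Vec.toList (Any.map (λ { refl → v∈ }) B∈)))

      F-blocks = blocks⁻ F (subst Unique (sym F++rest≡U) U!)

      Bs : List (Vec (Fin n) k)
      Bs = M ++ F

      Bs# : AllPairs _#_ Bs
      Bs# = AllPairs.++⁺ (Matching.disjoint matching) (proj₂ F-blocks)
        (All.tabulate (λ B∈ → All.tabulate (λ B′∈ (p , p′) → M∩U B∈ p (F⊆U B′∈ p′))))
        where import Data.List.Relation.Unary.AllPairs.Properties as AllPairs

      Bs! : All (Unique ∘ Vec.toList) Bs
      Bs! = All.++⁺ (All.map (λ {B} → edge⇒Unique H B) (Matching.edges matching)) (proj₁ F-blocks)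
        where import Data.List.Relation.Unary.All.Properties as All

      N : ℕ
      N = length Bs

      W : List (Fin n)
      W = vertices Bs

      W! : Unique W
      W! = Unique.concat⁺ (All.map⁺ Bs!) (AllPairs.map⁺ Bs#)
        where
        import Data.List.Relation.Unary.All.Properties as All
        import Data.List.Relation.Unary.AllPairs.Properties as AllPairs

      Nk≤n : N * k ≤ n
      Nk≤n = subst₂ _≤_ (length-vertices Bs) (length-tabulate {n = n} (λ i → i)) (length≤-inclusion W! (λ {x} _ → ∈-allFin x))

      covered : ∀ v → v ∈ W ++ rest
      covered v with v ∈ˢ? ⋃ (map support M)
      ... | yes v∈ = ∈-++⁺ˡ (subst (v ∈_) (sym (concatMap-++ Vec.toList M F)) (∈-++⁺ˡ (∈-⋃⁻ M v∈)))
      ... | no v∉ with ∈-++⁻ (vertices F) (subst (v ∈_) (sym F++rest≡U) (∈-elements⁺ (x∉p⇒x∈∁p v∉)))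
      ... | inj₁ v∈F = ∈-++⁺ˡ (subst (v ∈_) (sym (concatMap-++ Vec.toList M F)) (∈-++⁺ʳ (vertices M) v∈F))
      ... | inj₂ v∈rest = ∈-++⁺ʳ W v∈rest

      n<k*[N+1] : n < k * (N + 1)
      n<k*[N+1] = begin-strict
        n                          ≡⟨ length-tabulate {n = n} (λ i → i) ⟨
        length (allFin n)          ≤⟨ length≤-inclusion (Unique.allFin⁺ n) (λ {v} _ → covered v) ⟩
        length (W ++ rest)         ≡⟨ trans (length-++ W) (cong (_+ length rest) (length-vertices Bs)) ⟩
        N * k + length rest        <⟨ +-monoʳ-< (N * k) short ⟩
        N * k + k                  ≡⟨ trans (+-comm (N * k) k) (trans (*-comm (suc N) k) (cong (k *_) (+-comm 1 N))) ⟩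
        k * (N + 1)                ∎

      N-large : size₂ ≤ N
      N-large = ≤-trans (n≤1+n size₂) (≤-pred (subst (suc (suc size₂) ≤_) (+-comm N 1)
        (*-cancelˡ-< k (suc size₂) (N + 1) (≤-<-trans n-large n<k*[N+1]))))

      rκ<N : r * suc κ < N
      rκ<N = ≤-trans size₂≥r N-large

      N>0 : 0 < N
      N>0 = ≤-trans (s≤s z≤n) rκ<N

      d+4d²≤u : d + d * d * 4 ≤ u
      d+4d²≤u = ≤-trans size₁≥d u-large

      d≤u : d ≤ u
      d≤u = ≤-trans (m≤m+n d _) d+4d²≤u

      u>0 : 0 < u
      u>0 = ≤-trans (s≤s z≤n) d≤u

      Good : Vec (Fin n) d → Set
      Good s = Unique (Vec.toList s) × ¬ Bad (support s)
      good? : ∀ s → Dec (Good s)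
      good? s = unique? (Vec.toList s) ×-dec ¬? (bad? (support s))
      Gs : List (Vec (Fin n) d)
      Gs = filter good? (tuples U d)

      unique≤good+bad : (u ∸ d) ^ d ≤ length Gs + d ! * length (filter bad? (dSets n d))
      unique≤good+bad = begin
        (u ∸ d) ^ d                                              ≤⟨ uniqueTuples≥ U U! d ⟩
        ∑[ s ∈ tuples U d ] ⟦ unique? (Vec.toList s) ⟧            ≤⟨ ∑-mono (tuples U d) (λ {s} _ → split s) ⟩
        ∑[ s ∈ tuples U d ] (⟦ good? s ⟧ + ⟦ badSize? s ⟧)        ≡⟨ ∑-+ (tuples U d) _ _ ⟩
        ∑[ s ∈ tuples U d ] ⟦ good? s ⟧ + ∑[ s ∈ tuples U d ] ⟦ badSize? s ⟧ ≡⟨ cong (_+ ∑[ s ∈ tuples U d ] ⟦ badSize? s ⟧) (length-filter≡∑ good? (tuples U d)) ⟨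
        length Gs + ∑[ s ∈ tuples U d ] ⟦ badSize? s ⟧            ≤⟨ +-monoʳ-≤ (length Gs) (≤-trans (tuples-⊆ {m = d} U! (λ {x} _ → ∈-allFin x) (λ s → ⟦ badSize? s ⟧)) (bad-tuples≤ bad? d)) ⟩
        length Gs + d ! * length (filter bad? (dSets n d))       ∎
        where
        badSize? : ∀ s → Dec (Bad (support s) × ∣ support s ∣ ≡ d)
        badSize? s = bad? (support s) ×-dec (∣ support s ∣ ℕ.≟ d)
        split : ∀ s → ⟦ unique? (Vec.toList s) ⟧ ≤ ⟦ good? s ⟧ + ⟦ badSize? s ⟧
        split s = by-cases (unique? (Vec.toList s)) (bad? (support s))
          where
          by-cases : ∀ (uq : Dec (Unique (Vec.toList s))) (bd : Dec (Bad (support s))) →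
            ⟦ uq ⟧ ≤ ⟦ uq ×-dec ¬? bd ⟧ + ⟦ bd ×-dec (∣ support s ∣ ℕ.≟ d) ⟧
          by-cases (no _) _ = z≤n
          by-cases (yes _) (no ¬b) = s≤s z≤n
          by-cases (yes s!) (yes b) = ≤-reflexive (sym (⟦⟧≡1 (yes b ×-dec (∣ support s ∣ ℕ.≟ d)) (b , Unique⇒∣support∣ s s!)))

      -- At least 3/4 of the d-tuples in `U` are injective and at most 1/8 are bad, so 5/8 of them
      -- are good.
      u^d≤2Gs : u ^ d ≤ 2 * length Gs
      u^d≤2Gs = *-cancelˡ-≤ 4 (≤-trans (*-monoˡ-≤ (u ^ d) (n≤1+n 4)) (+-cancelʳ-≤ (u ^ d) _ _ (begin
        5 * u ^ d + u ^ d               ≡⟨ e₁ (u ^ d) ⟩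
        2 * (3 * u ^ d)                 ≤⟨ *-monoʳ-≤ 2 close ⟩
        2 * (4 * (u ∸ d) ^ d)           ≡⟨ *-assoc 2 4 ((u ∸ d) ^ d) ⟨
        8 * (u ∸ d) ^ d                 ≤⟨ *-monoʳ-≤ 8 unique≤good+bad ⟩
        8 * (length Gs + d ! * length (filter bad? (dSets n d))) ≡⟨ *-distribˡ-+ 8 (length Gs) _ ⟩
        8 * length Gs + 8 * (d ! * length (filter bad? (dSets n d))) ≤⟨ +-monoʳ-≤ (8 * length Gs) few-bad ⟩
        8 * length Gs + u ^ d           ≡⟨ cong (_+ u ^ d) (*-assoc 4 2 (length Gs)) ⟩
        4 * (2 * length Gs) + u ^ d     ∎)))
        where
        e₁ : ∀ x → 5 * x + x ≡ 2 * (3 * x)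
        e₁ = solve-∀
        close : 3 * u ^ d ≤ 4 * (u ∸ d) ^ d
        close = subst (λ x → 3 * x ^ d ≤ 4 * (u ∸ d) ^ d) (m∸n+n≡m d≤u)
          (power-close 3 (u ∸ d) d d (subst (0 <_) (sym (m∸n+n≡m d≤u)) u>0)
            (subst (d * d * 4 ≤_) (sym (m∸n+n≡m d≤u)) (≤-trans (m≤n+m (d * d * 4) d) d+4d²≤u)))

      ext : Subset n → ℕ
      ext = extensions {r = r} {d = d} H

      E? : (s : Vec (Fin n) d) (v : Vec (Fin n) r) → Dec (edge H (support s ∪ support v) ≡ true)
      E? s v = IsEdge? H (support s ∪ support v)

      R? : (x : Vec (Fin k) r) (sb : Vec (Fin n) d × Vec (Vec (Fin n) k) r) → Dec (edge H (support (proj₁ sb) ∪ support (pick (proj₂ sb) x)) ≡ true)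
      R? x (s , b) = E? s (pick b x)

      -- Let a, b, c be the r-th powers of N - 1, N, N + 1. Since k (N - 1) ≤ n - d - r, the degree
      -- condition gives at least (q t′ + Z) a / q extending tuples; since n < k (N + 1), at most Z
      -- (c - b) tuples leave the blocks. `absorb-errors` pays for the differences with the slack
      -- from γ.
      block-degree : ∀ s → Good s → (q * t′ + 1) * N ^ r ≤ q * ∑[ b ∈ tuples Bs r ] ∑[ x ∈ allTuples k r ] ⟦ E? s (pick b x) ⟧
      block-degree s (s! , ¬bad) = absorb-errors q t′ Z (N′ ^ r) (N ^ r) ((N + 1) ^ r) (ext S) _ 2≤Z
        (^-monoˡ-≤ r (m∸n≤m N 1))
        (power-close κ N 1 r (m≤n⇒m≤n+o 1 N>0) (subst (λ x → x * suc κ ≤ N + 1) (sym (+-identityʳ r)) (≤-trans (<⇒≤ rκ<N) (m≤m+n N 1))))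
        (subst (λ x → κ * x ^ r ≤ suc κ * N′ ^ r) N′+1≡N
          (power-close κ N′ 1 r (subst (0 <_) (sym N′+1≡N) N>0) (subst₂ (λ x y → x * suc κ ≤ y) (sym (+-identityʳ r)) (sym N′+1≡N) (<⇒≤ rκ<N))))
        ext≥ (begin
          ext S + Z * N ^ r       ≡⟨ cong (ext S +_) (trans (sym ([k*m]^r N)) (cong (_^ r) (trans (*-comm k N) (sym (length-vertices Bs))))) ⟩
          ext S + length W ^ r    ≤⟨ ∑-outside {m = r} (E? s) W W! ⟩
          n ^ r + ∑[ v ∈ tuples W r ] ⟦ E? s v ⟧ ≡⟨ cong (n ^ r +_) (∑-blocks Bs r (λ v → ⟦ E? s v ⟧)) ⟩
          n ^ r + ∑[ b ∈ tuples Bs r ] ∑[ x ∈ allTuples k r ] ⟦ E? s (pick b x) ⟧ ≤⟨ +-monoˡ-≤ _ (≤-trans (^-monoˡ-≤ r (<⇒≤ n<k*[N+1])) (≤-reflexive ([k*m]^r (N + 1)))) ⟩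
          Z * (N + 1) ^ r + ∑[ b ∈ tuples Bs r ] ∑[ x ∈ allTuples k r ] ⟦ E? s (pick b x) ⟧ ∎)
        where
        S = support s
        ∣S∣≡d = Unique⇒∣support∣ s s!
        N′ = N ∸ 1
        N′+1≡N : N′ + 1 ≡ N
        N′+1≡N = m∸n+n≡m N>0
        kN′≤ : k * N′ ≤ n ∸ d ∸ r
        kN′≤ = subst (k * N′ ≤_) (sym (∸-+-assoc n d r)) (m+n≤o⇒m≤o∸n (k * N′) (begin
          k * N′ + k       ≡⟨ cong (k * N′ +_) (*-identityʳ k) ⟨
          k * N′ + k * 1   ≡⟨ *-distribˡ-+ k N′ 1 ⟨
          k * (N′ + 1)     ≡⟨ trans (cong (k *_) N′+1≡N) (*-comm k N) ⟩
          N * k            ≤⟨ Nk≤n ⟩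
          n                ∎))
        ext≥ : (q * t′ + Z) * N′ ^ r ≤ q * ext S
        ext≥ = *-cancelˡ-≤ Z {{>-nonZero Z>0}} (begin
          Z * ((q * t′ + Z) * N′ ^ r)      ≡⟨ e₁ Z (q * t′ + Z) (N′ ^ r) ⟩
          (q * t′ + Z) * (Z * N′ ^ r)      ≡⟨ cong ((q * t′ + Z) *_) ([k*m]^r N′) ⟨
          (q * t′ + Z) * (k * N′) ^ r      ≤⟨ *-monoʳ-≤ (q * t′ + Z) (≤-trans (^-monoˡ-≤ r kN′≤) ([n∸m]^m≤m!*nCm (n ∸ d) r)) ⟩
          (q * t′ + Z) * (r ! * ((n ∸ d) C r)) ≡⟨ e₁ (q * t′ + Z) (r !) _ ⟩
          r ! * ((q * t′ + Z) * ((n ∸ d) C r)) ≤⟨ *-monoʳ-≤ (r !) (large-degree S ∣S∣≡d ¬bad) ⟩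
          r ! * (q * Z * deg H S)          ≡⟨ e₂ (r !) q Z (deg H S) ⟩
          Z * (q * (r ! * deg H S))        ≤⟨ *-monoʳ-≤ Z (*-monoʳ-≤ q (r!*deg≤extensions {r = r} {d = d} H S ∣S∣≡d)) ⟩
          Z * (q * ext S)         ∎)
          where
          e₁ : ∀ a b c → a * (b * c) ≡ b * (a * c)
          e₁ = solve-∀
          e₂ : ∀ f q Z x → f * (q * Z * x) ≡ Z * (q * (f * x))
          e₂ = solve-∀

      ys : List (Vec (Fin n) d × Vec (Vec (Fin n) k) r)
      ys = cartesianProduct Gs (tuples Bs r)

      length-ys : length ys ≡ length Gs * N ^ r
      length-ys = trans (length-cartesianProductWith _,_ Gs (tuples Bs r)) (cong (length Gs *_) (length-tuples Bs r))

      Gs>0 : 0 < length Gs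
      Gs>0 = *-cancelˡ-< 2 0 (length Gs) (≤-trans (m^n>0 u {{>-nonZero u>0}} d) u^d≤2Gs)

      N^r>0 : 0 < N ^ r
      N^r>0 = m^n>0 N {{>-nonZero N>0}} r

      abstract
        common : Σ (List (Vec (Fin k) r)) λ g → g ⊑ allTuples k r × t′ < length g ×
          length ys ≤ q * length (allTuples k r) * 2 ^ length (allTuples k r) * ∑[ y ∈ ys ] ⟦ All.all? (λ x → R? x y) g ⟧
        common = common-sublist R? t′ q (allTuples k r) ys (subst (0 <_) (sym length-ys) (*-pos Gs>0 N^r>0)) (begin
          (q * t′ + 1) * length ys             ≡⟨ cong ((q * t′ + 1) *_) length-ys ⟩
          (q * t′ + 1) * (length Gs * N ^ r)   ≡⟨ e₁ (q * t′ + 1) (length Gs) (N ^ r) ⟩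
          length Gs * ((q * t′ + 1) * N ^ r)   ≤⟨ ∑-bound′ Gs (λ {s} s∈ → block-degree s (proj₂ (∈-filter⁻ good? {xs = tuples U d} s∈))) ⟩
          ∑[ s ∈ Gs ] (q * ∑[ b ∈ tuples Bs r ] ∑[ x ∈ allTuples k r ] ⟦ E? s (pick b x) ⟧) ≡⟨ ∑-*ˡ q Gs _ ⟩
          q * ∑[ s ∈ Gs ] ∑[ b ∈ tuples Bs r ] ∑[ x ∈ allTuples k r ] ⟦ E? s (pick b x) ⟧ ≡⟨ cong (q *_) (∑-cartesianProductWith _,_ Gs (tuples Bs r) _) ⟨
          q * ∑[ y ∈ ys ] ∑[ x ∈ allTuples k r ] ⟦ R? x y ⟧ ∎)
          where
          e₁ : ∀ a b c → a * (b * c) ≡ b * (a * c)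
          e₁ = solve-∀

      g : List (Vec (Fin k) r)
      g = proj₁ common

      P? : ∀ (s : Vec (Fin n) d) (b : Vec (Vec (Fin n) k) r) → Dec (All (λ x → edge H (support s ∪ support (pick b x)) ≡ true) g)
      P? s b = All.all? (λ x → R? x (s , b)) g

      dense₁ : u ^ d * length (tuples Bs r) ≤ density₁ * ∑[ s ∈ tuples U d ] ∑[ b ∈ tuples Bs r ] ⟦ P? s b ⟧
      dense₁ = begin
        u ^ d * length (tuples Bs r)          ≤⟨ *-monoˡ-≤ (length (tuples Bs r)) u^d≤2Gs ⟩
        2 * length Gs * length (tuples Bs r)  ≡⟨ trans (*-assoc 2 (length Gs) _) (cong (2 *_) (sym (length-cartesianProductWith _,_ Gs (tuples Bs r)))) ⟩
        2 * length ys                         ≤⟨ *-monoʳ-≤ 2 (subst (λ l → length ys ≤ q * l * 2 ^ l * ∑[ y ∈ ys ] ⟦ P? (proj₁ y) (proj₂ y) ⟧) (trans (length-allTuples k r) (sym Z≡)) (proj₂ (proj₂ (proj₂ common)))) ⟩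
        2 * (q * Z * 2 ^ Z * ∑[ y ∈ ys ] ⟦ P? (proj₁ y) (proj₂ y) ⟧) ≡⟨ trans (sym (*-assoc 2 (q * Z * 2 ^ Z) _)) (cong (_* ∑[ y ∈ ys ] ⟦ P? (proj₁ y) (proj₂ y) ⟧) (sym density₁≡)) ⟩
        density₁ * ∑[ y ∈ ys ] ⟦ P? (proj₁ y) (proj₂ y) ⟧ ≡⟨ cong (density₁ *_) (∑-cartesianProductWith _,_ Gs (tuples Bs r) _) ⟩
        density₁ * ∑[ s ∈ Gs ] ∑[ b ∈ tuples Bs r ] ⟦ P? s b ⟧ ≤⟨ *-monoʳ-≤ density₁ (∑-filter good? (tuples U d) _) ⟩
        density₁ * ∑[ s ∈ tuples U d ] ∑[ b ∈ tuples Bs r ] ⟦ P? s b ⟧ ∎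

      P : Vec (Fin n) d → Vec (Vec (Fin n) k) r → Set
      P s b = All (λ x → edge H (support s ∪ support (pick b x)) ≡ true) g

      abstract
        -- The block tuples are the parameter here, so the chosen vertices of `U` work for a dense
        -- set of block tuples at once.
        pools₁ : Sep.Pools (suc t₀) d U [] (boxDensity t₀ d density₁) (tuples Bs r) P
        pools₁ = Sep.box t₀ 1 d density₁ (λ _ → ≤-refl) P? U (tuples Bs r) [] density₁>0
          (subst (0 <_) (sym (length-tuples Bs r)) N^r>0)
          (AllPairs.map (λ { ne (here refl , here e) → ne e }) U!)
          (≤-trans size₁≥box u-large) dense₁
      module SP = Sep.Pools pools₁

      -- The blocks of `F` lie in `U` and could contain the vertices just chosen; `T` forbids this
      -- in the second box.
      T : List (Fin n)
      T = cartesianProductWith SP.pool (allFin d) (allFin (suc t₀))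

      length-T : length T ≡ d * suc t₀
      length-T = trans (length-cartesianProductWith SP.pool (allFin d) (allFin (suc t₀)))
        (cong₂ _*_ (length-tabulate {n = d} (λ i → i)) (length-tabulate {n = suc t₀} (λ i → i)))

      -- No parameter remains for the second box. On a one-point list, positive density of `Q` means
      -- that `Q` holds.
      tts : List ⊤
      tts = tt ∷ []

      abstract
        pools₂ : BlockBoxes.Pools (suc t₀) r Bs T (boxDensity t₀ r density₂) tts (λ b _ → SP.Q b)
        pools₂ = BlockBoxes.box t₀ k r density₂ (λ B → ≤-reflexive (length-toList B)) (λ b (_ : ⊤) → SP.Q? b) Bs tts T
          density₂>0 (s≤s z≤n) Bs#
          (subst (λ f → boxSize t₀ k r density₂ f ≤ N) (sym length-T) (≤-trans size₂≥box N-large))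
          (begin
            N ^ r * 1                                             ≡⟨ trans (*-identityʳ (N ^ r)) (sym (length-tuples Bs r)) ⟩
            length (tuples Bs r)                                  ≤⟨ subst (λ D → length (tuples Bs r) ≤ D * ∑[ b ∈ tuples Bs r ] ⟦ SP.Q? b ⟧) (sym density₂≡) SP.many ⟩
            density₂ * ∑[ b ∈ tuples Bs r ] ⟦ SP.Q? b ⟧           ≡⟨ cong (density₂ *_) (∑-cong (tuples Bs r) (λ b → sym (+-identityʳ ⟦ SP.Q? b ⟧))) ⟩
            density₂ * ∑[ b ∈ tuples Bs r ] ∑[ y ∈ tts ] ⟦ SP.Q? b ⟧ ∎)
      module BP = BlockBoxes.Pools pools₂

      Q-tt : BP.Q tt
      Q-tt with BP.Q? tt | BP.many
      ... | yes Qtt | _ = Qtt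
      ... | no _ | 1≤ = contradiction (≤-trans 1≤ (≤-reflexive (*-zeroʳ (boxDensity t₀ r density₂)))) λ ()

      bm : BlowUpMatching k r (suc t₀) g
      bm = BlowUps.blowUp g (AllPairs-resp-⊑ (proj₁ (proj₂ common)) (tuples⁺ (Unique.allFin⁺ k)))
        (s≤s (m≤n+m r d₀))
        (≤-reflexive (trans (sym Z≡) (sym t₀≡)))
        (subst (_≤ length g) t′≡ (proj₁ (proj₂ (proj₂ common))))

      augmented : ∃[ M′ ] Matching H M′ × length M < length M′
      augmented = Replacement.replace H M Bs U matching ∈-++⁺ˡ Bs# Bs! M∩U
        SP.pool SP.pool∈ (λ j i j′ i′ e → proj₂ (SP.separated j i j′ i′ (here refl) (here e)))
        BP.pool BP.pool∈ BP.separated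
        (λ j i j′ i′ v∈ → BP.avoids j′ i′ (v∈ , ∈-cartesianProductWith⁺ SP.pool (∈-allFin j) (∈-allFin i)))
        bm
        -- The constant choice `λ _ → i` is the tuple of `i`-th pool vertices that new edge `i`
        -- uses.
        (λ i c x∈g → All.lookup (SP.Q⇒P (BP.Q⇒P Q-tt c) (λ _ → i)) x∈g)

    augment : size₁ ≤ length (leftover M) → k * suc size₂ ≤ n → 8 * (d ! * length (filter bad? (dSets n d))) ≤ length (leftover M) ^ d →
      ∃[ M′ ] Matching H M′ × length M < length M′
    augment u-large n-large few-bad = let F , rest , F++rest≡U , short = chop k (length (leftover M)) (leftover M) ≤-refl in
      augmented u-large n-large few-bad F rest F++rest≡U short

-- Clearing denominators

toℚᵘ-toℚ : ∀ n → toℚᵘ (toℚ n) ≃ mkℚᵘ (ℤ.+ n) 0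
toℚᵘ-toℚ n = ℚ.toℚᵘ-fromℚᵘ (mkℚᵘ (ℤ.+ n) 0)

toℚ-+ : ∀ m n → toℚ (m + n) ≡ toℚ m ℚ.+ toℚ n
toℚ-+ m n = ℚ.toℚᵘ-injective (begin
  toℚᵘ (toℚ (m + n))               ≈⟨ toℚᵘ-toℚ (m + n) ⟩
  mkℚᵘ (ℤ.+ (m + n)) 0               ≈⟨ *≡* (cong (ℤ._* ℤ.+ 1) (cong₂ ℤ._+_ (sym (ℤ.*-identityʳ (ℤ.+ m))) (sym (ℤ.*-identityʳ (ℤ.+ n))))) ⟩
  mkℚᵘ (ℤ.+ m) 0 ℚᵘ.+ mkℚᵘ (ℤ.+ n) 0   ≈⟨ ℚᵘ.+-cong (toℚᵘ-toℚ m) (toℚᵘ-toℚ n) ⟨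
  toℚᵘ (toℚ m) ℚᵘ.+ toℚᵘ (toℚ n)   ≈⟨ ℚ.toℚᵘ-homo-+ (toℚ m) (toℚ n) ⟨
  toℚᵘ (toℚ m ℚ.+ toℚ n)           ∎)
  where open ℚᵘ.≃-Reasoning

toℚ-* : ∀ m n → toℚ (m * n) ≡ toℚ m ℚ.* toℚ n
toℚ-* m n = ℚ.toℚᵘ-injective (begin
  toℚᵘ (toℚ (m * n))               ≈⟨ toℚᵘ-toℚ (m * n) ⟩
  mkℚᵘ (ℤ.+ (m * n)) 0               ≈⟨ *≡* (cong (ℤ._* ℤ.+ 1) (ℤ.pos-* m n)) ⟩
  mkℚᵘ (ℤ.+ m) 0 ℚᵘ.* mkℚᵘ (ℤ.+ n) 0   ≈⟨ ℚᵘ.*-cong (toℚᵘ-toℚ m) (toℚᵘ-toℚ n) ⟨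
  toℚᵘ (toℚ m) ℚᵘ.* toℚᵘ (toℚ n)   ≈⟨ ℚ.toℚᵘ-homo-* (toℚ m) (toℚ n) ⟨
  toℚᵘ (toℚ m ℚ.* toℚ n)           ∎)
  where open ℚᵘ.≃-Reasoning

toℚ-^ : ∀ n m → toℚ n ^ℚ m ≡ toℚ (n ^ m)
toℚ-^ n zero    = refl
toℚ-^ n (suc m) = trans (cong (toℚ n ℚ.*_) (toℚ-^ n m)) (sym (toℚ-* n (n ^ m)))

toℚ-mono-≤ : ∀ m n → m ≤ n → toℚ m ℚ.≤ toℚ n
toℚ-mono-≤ m n m≤n = ℚ.toℚᵘ-cancel-≤ (ℚᵘ.≤-respˡ-≃ (ℚᵘ.≃-sym (toℚᵘ-toℚ m)) (ℚᵘ.≤-respʳ-≃ (ℚᵘ.≃-sym (toℚᵘ-toℚ n))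
  (*≤* (ℤ.*-monoʳ-≤-nonNeg (ℤ.+ 1) (ℤ.+≤+ m≤n)))))

toℚ-cancel-≤ : ∀ m n → toℚ m ℚ.≤ toℚ n → m ≤ n
toℚ-cancel-≤ m n p with ℚᵘ.≤-respˡ-≃ (toℚᵘ-toℚ m) (ℚᵘ.≤-respʳ-≃ (toℚᵘ-toℚ n) (ℚ.toℚᵘ-mono-≤ p))
... | *≤* q = ℤ.drop‿+≤+ (subst₂ ℤ._≤_ (ℤ.*-identityʳ (ℤ.+ m)) (ℤ.*-identityʳ (ℤ.+ n)) q)

*-toℚ-denominator : ∀ p a b → toℚᵘ p ≃ mkℚᵘ (ℤ.+ a) b → p ℚ.* toℚ (suc b) ≡ toℚ a
*-toℚ-denominator p a b p≃ = ℚ.toℚᵘ-injective (begin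
  toℚᵘ (p ℚ.* toℚ (suc b))              ≈⟨ ℚ.toℚᵘ-homo-* p (toℚ (suc b)) ⟩
  toℚᵘ p ℚᵘ.* toℚᵘ (toℚ (suc b))        ≈⟨ ℚᵘ.*-cong p≃ (toℚᵘ-toℚ (suc b)) ⟩
  mkℚᵘ (ℤ.+ a) b ℚᵘ.* mkℚᵘ (ℤ.+ suc b) 0    ≈⟨ *≡* (trans (ℤ.*-identityʳ (ℤ.+ a ℤ.* ℤ.+ suc b)) (cong (λ c → ℤ.+ a ℤ.* ℤ.+ c) (sym (*-identityʳ (suc b))))) ⟩
  mkℚᵘ (ℤ.+ a) 0                          ≈⟨ toℚᵘ-toℚ a ⟨
  toℚᵘ (toℚ a)                          ∎)
  where open ℚᵘ.≃-Reasoning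

frac-*-toℚ : ∀ a b → 0 < b → frac a b ℚ.* toℚ b ≡ toℚ a
frac-*-toℚ a (suc b) _ = *-toℚ-denominator (frac a (suc b)) a b (ℚ.toℚᵘ-fromℚᵘ (mkℚᵘ (ℤ.+ a) b))

positive-fraction : ∀ p → 0ℚ ℚ.< p → ∃[ a ] ∃[ b ] 0 < a × 0 < b × p ℚ.* toℚ b ≡ toℚ a
positive-fraction p@(mkℚ (ℤ.+ suc a) b _) _ = suc a , suc b , s≤s z≤n , s≤s z≤n , *-toℚ-denominator p (suc a) b ℚᵘ.≃-refl
positive-fraction p@(mkℚ (ℤ.+ zero) b _) 0<p with ℚ.drop-*<* 0<p
... | ℤ.+<+ ()
positive-fraction p@(mkℚ -[1+ a ] b _) 0<p with ℚ.drop-*<* 0<p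
... | ()

toℚ-nonNegative : ∀ n → ℚ.NonNegative (toℚ n)
toℚ-nonNegative n = ℚ.nonNegative (toℚ-mono-≤ 0 n z≤n)

toℚ-positive : ∀ n → 0 < n → ℚ.Positive (toℚ n)
toℚ-positive n 0<n = ℚ.positive (ℚ.<-≤-trans (ℚ.*<* (ℤ.+<+ (s≤s z≤n))) (toℚ-mono-≤ 1 n 0<n))

-- Of γ only the bound γ ≥ 1 / q is kept.
clear-threshold : ∀ r k K₁ Z t′ q c D γ g → 0 < k → k * K₁ ≡ Z → 0 < Z → suc t′ ≡ r * K₁ → 0 < g → γ ℚ.* toℚ q ≡ toℚ g →
  ((frac r k ℚ.- frac 1 Z) ℚ.+ γ) ℚ.* toℚ c ℚ.≤ toℚ D → (q * t′ + Z) * c ≤ q * Z * D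
clear-threshold r k K₁ Z t′ q c D γ g k>0 kK₁≡Z Z>0 t′≡ g>0 γq≡g deg = begin
  (q * t′ + Z) * c         ≤⟨ *-monoˡ-≤ c (+-monoʳ-≤ (q * t′) (m≤n*m Z g {{>-nonZero g>0}})) ⟩
  (q * t′ + g * Z) * c     ≤⟨ toℚ-cancel-≤ ((q * t′ + g * Z) * c) (D * (q * Z)) scaled ⟩
  D * (q * Z)              ≡⟨ *-comm D (q * Z) ⟩
  q * Z * D                ∎
  where
  open ≤-Reasoning
  open ℚ.+-*-Solver
  f₁ = frac r k
  f₂ = frac 1 Z
  f₁Z : f₁ ℚ.* toℚ Z ≡ toℚ t′ ℚ.+ 1ℚ
  f₁Z = trans (cong (λ z → f₁ ℚ.* toℚ z) (sym kK₁≡Z)) (trans (cong (f₁ ℚ.*_) (toℚ-* k K₁))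
    (trans (sym (ℚ.*-assoc f₁ (toℚ k) (toℚ K₁))) (trans (cong (ℚ._* toℚ K₁) (frac-*-toℚ r k k>0))
    (trans (sym (toℚ-* r K₁)) (trans (cong toℚ (trans (sym t′≡) (+-comm 1 t′))) (toℚ-+ t′ 1))))))
  expand : ∀ f₁ f₂ γ c q z → ((f₁ ℚ.- f₂) ℚ.+ γ) ℚ.* c ℚ.* (q ℚ.* z) ≡ ((f₁ ℚ.* z ℚ.* q ℚ.- f₂ ℚ.* z ℚ.* q) ℚ.+ γ ℚ.* q ℚ.* z) ℚ.* c
  expand = solve 6 (λ f₁ f₂ γ c q z → ((f₁ :- f₂) :+ γ) :* c :* (q :* z) := ((f₁ :* z :* q :- f₂ :* z :* q) :+ γ :* q :* z) :* c) refl
  collect : ∀ t q gz c → (((t ℚ.+ 1ℚ) ℚ.* q ℚ.- 1ℚ ℚ.* q) ℚ.+ gz) ℚ.* c ≡ (q ℚ.* t ℚ.+ gz) ℚ.* c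
  collect = solve 4 (λ t q gz c → (((t :+ con 1ℚ) :* q :- con 1ℚ :* q) :+ gz) :* c := (q :* t :+ gz) :* c) refl
  -- Scaled by `q * Z`, the fraction `r / k` becomes `q * (t′ + 1)` and `1 / Z` becomes `q`, which
  -- leaves `q * t′`.
  value : ((f₁ ℚ.- f₂) ℚ.+ γ) ℚ.* toℚ c ℚ.* toℚ (q * Z) ≡ toℚ ((q * t′ + g * Z) * c)
  value = trans (cong (((f₁ ℚ.- f₂) ℚ.+ γ) ℚ.* toℚ c ℚ.*_) (toℚ-* q Z)) (trans (expand f₁ f₂ γ (toℚ c) (toℚ q) (toℚ Z))
    (trans (cong₂ (λ x y → ((x ℚ.* toℚ q ℚ.- y) ℚ.+ γ ℚ.* toℚ q ℚ.* toℚ Z) ℚ.* toℚ c) f₁Z (cong (ℚ._* toℚ q) (frac-*-toℚ 1 Z Z>0)))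
    (trans (cong (λ x → (((toℚ t′ ℚ.+ 1ℚ) ℚ.* toℚ q ℚ.- 1ℚ ℚ.* toℚ q) ℚ.+ x) ℚ.* toℚ c) (trans (cong (ℚ._* toℚ Z) γq≡g) (sym (toℚ-* g Z))))
    (trans (collect (toℚ t′) (toℚ q) (toℚ (g * Z)) (toℚ c))
    (trans (cong (λ x → (x ℚ.+ toℚ (g * Z)) ℚ.* toℚ c) (sym (toℚ-* q t′)))
    (trans (cong (ℚ._* toℚ c) (sym (toℚ-+ (q * t′) (g * Z)))) (sym (toℚ-* (q * t′ + g * Z) c))))))))
  scaled : toℚ ((q * t′ + g * Z) * c) ℚ.≤ toℚ (D * (q * Z))
  scaled = subst₂ ℚ._≤_ value (sym (toℚ-* D (q * Z))) (ℚ.*-monoʳ-≤-nonNeg (toℚ (q * Z)) {{toℚ-nonNegative (q * Z)}} deg)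

module _ {n k : ℕ} (H : KGraph n k) (d : ℕ) (γ : ℚ) where

  LowDegree : Subset n → Set
  LowDegree S = ¬ (threshold n k d γ ℚ.≤ toℚ (deg H S))

  lowDegree? : ∀ S → Dec (LowDegree S)
  lowDegree? S = ¬? (threshold n k d γ ℚ.≤? toℚ (deg H S))

  badCount≡ : badCount H d γ ≡ length (filter lowDegree? (dSets n d))
  badCount≡ = refl

  large-degree : ∀ r K₁ Z t′ q g → k ∸ d ≡ r → Z ≡ k ^ r → 0 < k → k * K₁ ≡ Z → 0 < Z → suc t′ ≡ r * K₁ → 0 < g → γ ℚ.* toℚ q ≡ toℚ g →
    ∀ S → ¬ LowDegree S → (q * t′ + Z) * ((n ∸ d) C r) ≤ q * Z * deg H S
  large-degree r K₁ Z t′ q g refl refl k>0 kK₁≡Z Z>0 t′≡ g>0 γq≡g S ¬low =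
    clear-threshold r k K₁ Z t′ q ((n ∸ d) C r) (deg H S) γ g k>0 kK₁≡Z Z>0 t′≡ g>0 γq≡g
      (decidable-stable (threshold n k d γ ℚ.≤? toℚ (deg H S)) ¬low)

clear-bad : ∀ ε a b x y → ε ℚ.* toℚ b ≡ toℚ a → toℚ x ℚ.≤ ε ℚ.* toℚ y → x * b ≤ a * y
clear-bad ε a b x y εb≡a h = toℚ-cancel-≤ (x * b) (a * y) (subst₂ ℚ._≤_ (sym (toℚ-* x b))
  (trans (swap ε (toℚ y) (toℚ b)) (trans (cong (ℚ._* toℚ y) εb≡a) (sym (toℚ-* a y))))
  (ℚ.*-monoʳ-≤-nonNeg (toℚ b) {{toℚ-nonNegative b}} h))
  where
  open ℚ.+-*-Solver
  swap : ∀ ε y b → ε ℚ.* y ℚ.* b ≡ ε ℚ.* b ℚ.* y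
  swap = solve 3 (λ ε y b → ε :* y :* b := ε :* b :* y) refl

-- The bound u ≤ 2 ε^(1/k) n is kept in the form of `k`-th powers, as ε^(1/k) need not be rational.
uncovered-bound : ∀ ε a b k u n → 0 < b → ε ℚ.* toℚ b ≡ toℚ a → u ^ k * b ≤ 2 ^ k * a * n ^ k →
  toℚ u ^ℚ k ℚ.≤ (toℚ 2 ^ℚ k) ℚ.* ε ℚ.* (toℚ n ^ℚ k)
uncovered-bound ε a b k u n b>0 εb≡a h = subst₂ ℚ._≤_ (sym (toℚ-^ u k))
  (sym (cong₂ (λ x y → x ℚ.* ε ℚ.* y) (toℚ-^ 2 k) (toℚ-^ n k)))
  (ℚ.*-cancelʳ-≤-pos (toℚ b) {{toℚ-positive b b>0}} (subst₂ ℚ._≤_ (toℚ-* (u ^ k) b) rhs (toℚ-mono-≤ (u ^ k * b) (2 ^ k * a * n ^ k) h)))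
  where
  open ℚ.+-*-Solver
  swap : ∀ x ε y b → x ℚ.* (ε ℚ.* b) ℚ.* y ≡ x ℚ.* ε ℚ.* y ℚ.* b
  swap = solve 4 (λ x ε y b → x :* (ε :* b) :* y := x :* ε :* y :* b) refl
  rhs : toℚ (2 ^ k * a * n ^ k) ≡ toℚ (2 ^ k) ℚ.* ε ℚ.* toℚ (n ^ k) ℚ.* toℚ b
  rhs = trans (toℚ-* (2 ^ k * a) (n ^ k)) (trans (cong (ℚ._* toℚ (n ^ k)) (trans (toℚ-* (2 ^ k) a) (cong (toℚ (2 ^ k) ℚ.*_) (sym εb≡a))))
    (swap (toℚ (2 ^ k)) ε (toℚ (n ^ k)) (toℚ b)))

-- u ^ (d + r) ≤ u ^ d * n ^ r, so the bound on u ^ (d + r) descends to u ^ d.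
descend : ∀ c b u n d r → 0 < n → u ≤ n → c * n ^ (d + r) < u ^ (d + r) * b → c * n ^ d < u ^ d * b
descend c b u n d r n>0 u≤n h = *-cancelʳ-< (n ^ r) _ _ (begin-strict
  c * n ^ d * n ^ r      ≡⟨ trans (*-assoc c (n ^ d) (n ^ r)) (cong (c *_) (sym (^-distribˡ-+-* n d r))) ⟩
  c * n ^ (d + r)        <⟨ h ⟩
  u ^ (d + r) * b        ≡⟨ cong (_* b) (^-distribˡ-+-* u d r) ⟩
  u ^ d * u ^ r * b      ≤⟨ *-monoˡ-≤ b (*-monoʳ-≤ (u ^ d) (^-monoˡ-≤ r u≤n)) ⟩
  u ^ d * n ^ r * b      ≡⟨ swap (u ^ d) (n ^ r) b ⟩
  u ^ d * b * n ^ r      ∎)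
  where
  open ≤-Reasoning
  swap : ∀ x y b → x * y * b ≡ x * b * y
  swap = solve-∀

-- Iterating the augmentation

module _ {n k : ℕ} (H : KGraph n (suc k)) where

  Matching⇒IsMatching : ∀ {M} → Matching H M → IsMatching H (map support M)
  Matching⇒IsMatching matching = All.map⁺ (Matching.edges matching) ,
    AllPairs.map⁺ (AllPairs.map disjoint (Matching.disjoint matching))
    where
    import Data.List.Relation.Unary.All.Properties as All
    import Data.List.Relation.Unary.AllPairs.Properties as AllPairs
    disjoint : ∀ {B B′} → Disjoint (Vec.toList B) (Vec.toList B′) → Empty (support B ∩ support B′)
    disjoint {B} {B′} B#B′ (x , x∈) = let x∈B , x∈B′ = x∈p∩q⁻ (support B) (support B′) x∈ in
      B#B′ (∈-support⁻ B x∈B , ∈-support⁻ B′ x∈B′)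

  ∣Matching∣≤n : ∀ {M} → Matching H M → length M ≤ n
  ∣Matching∣≤n {M} matching = begin
    length M            ≤⟨ m≤m*n (length M) (suc k) ⟩
    length M * suc k    ≡⟨ length-vertices M ⟨
    length (vertices M) ≤⟨ length≤-inclusion vertices! (λ {x} _ → ∈-allFin x) ⟩
    length (allFin n)   ≡⟨ length-tabulate {n = n} (λ i → i) ⟩
    n                   ∎
    where
    open ≤-Reasoning
    import Data.List.Relation.Unary.All.Properties as All
    import Data.List.Relation.Unary.AllPairs.Properties as AllPairs
    vertices! : Unique (vertices M)
    vertices! = Unique.concat⁺ (All.map⁺ (All.map (λ {B} → edge⇒Unique H B) (Matching.edges matching))) (AllPairs.map⁺ (Matching.disjoint matching))

  -- A matching has at most `n` edges, so `suc n` successive enlargements are impossible and some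
  -- stage is `Done`.
  enlarge-until : (Done : List (Vec (Fin n) (suc k)) → Set) →
    (∀ M → Matching H M → Done M ⊎ ∃[ M′ ] Matching H M′ × length M < length M′) →
    ∃[ M ] Matching H M × Done M
  enlarge-until Done step with reach (suc n)
    where
    reach : ∀ m → (∃[ M ] Matching H M × Done M) ⊎ (∃[ M ] Matching H M × m ≤ length M)
    reach zero = inj₂ ([] , record { edges = [] ; disjoint = [] } , z≤n)
    reach (suc m) with reach m
    ... | inj₁ done = inj₁ done
    ... | inj₂ (M , matching , m≤) with step M matching
    ... | inj₁ done = inj₁ (M , matching , done)
    ... | inj₂ (M′ , matching′ , <M′) = inj₂ (M′ , matching′ , ≤-<-trans m≤ <M′)
  ... | inj₁ done = done
  ... | inj₂ (M , matching , n<) = contradiction (≤-trans n< (∣Matching∣≤n matching)) (<-irrefl refl)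

module LargeMatchings (d₀ r₀ q g a b : ℕ) (params : Parameters d₀ r₀ q) (γ ε : ℚ) (g>0 : 0 < g) (γq≡g : γ ℚ.* toℚ q ≡ toℚ g)
  (a>0 : 0 < a) (b>0 : 0 < b) (εb≡a : ε ℚ.* toℚ b ≡ toℚ a) where

  open Parameters params

  private
    d = suc d₀
    r = 2 + r₀
    k = d + r

  large-matching : (n : ℕ) → suc (b * size₁ + k * suc size₂) ≤ n → (H : KGraph n k)
    → toℚ (badCount H d γ) ℚ.≤ ε ℚ.* toℚ (n C d)
    → Σ (List (Subset n)) λ M → IsMatching H M
    × (toℚ (n ∸ ∣ ⋃ M ∣) ^ℚ k ℚ.≤ (toℚ 2 ^ℚ k) ℚ.* ε ℚ.* (toℚ n ^ℚ k))
  large-matching n n-large H few = let M , matching , done = enlarge-until H Done step in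
    map support M , Matching⇒IsMatching H matching , uncovered-bound ε a b k (uncovered M) n b>0 εb≡a done
    where
    open ≤-Reasoning
    uncovered : List (Vec (Fin n) k) → ℕ
    uncovered M = n ∸ ∣ ⋃ (map support M) ∣
    Done : List (Vec (Fin n) k) → Set
    Done M = uncovered M ^ k * b ≤ 2 ^ k * a * n ^ k
    n>0 : 0 < n
    n>0 = ≤-trans (s≤s z≤n) n-large
    step : ∀ M → Matching H M → Done M ⊎ ∃[ M′ ] Matching H M′ × length M < length M′
    step M matching = decide (uncovered M ^ k * b ≤? 2 ^ k * a * n ^ k)
      where
      open Augmentation d₀ r₀ q params using (augment)
      u = uncovered M
      length-leftover : length (leftover M) ≡ u
      length-leftover = trans (length-elements (∁ (⋃ (map support M)))) (∣∁p∣≡n∸∣p∣ (⋃ (map support M)))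
      u≤n : u ≤ n
      u≤n = m∸n≤m n ∣ ⋃ (map support M) ∣
      module _ (many : 2 ^ k * a * n ^ k < u ^ k * b) where
        -- Descending to exponent 1 makes the uncovered set linear in `n`, which lets a large `n`
        -- guarantee `size₁`.
        n≤ub : n ≤ u * b
        n≤ub = begin
          n                     ≤⟨ m≤n*m n (2 ^ k * a) {{>-nonZero (*-pos (m^n>0 2 k) a>0)}} ⟩
          2 ^ k * a * n         ≡⟨ cong (2 ^ k * a *_) (^-identityʳ n) ⟨
          2 ^ k * a * n ^ 1     ≤⟨ <⇒≤ (descend (2 ^ k * a) b u n 1 (d₀ + r) n>0 u≤n many) ⟩
          u ^ 1 * b             ≡⟨ cong (_* b) (^-identityʳ u) ⟩
          u * b                 ∎
        size₁≤u : size₁ ≤ u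
        size₁≤u = *-cancelʳ-≤ size₁ u b {{>-nonZero b>0}} (begin
          size₁ * b        ≡⟨ *-comm size₁ b ⟩
          b * size₁        ≤⟨ ≤-trans (m≤m+n _ _) (<⇒≤ n-large) ⟩
          n                ≤⟨ n≤ub ⟩
          u * b            ∎)
        -- The constant 8 is afforded by `2 ^ k`, with `k ≥ 3`: this is where the factor 2 in front
        -- of ε^(1/k) is spent.
        few-bad : 8 * (d ! * badCount H d γ) ≤ u ^ d
        few-bad = *-cancelʳ-≤ _ (u ^ d) b {{>-nonZero b>0}} (begin
          8 * (d ! * badCount H d γ) * b    ≡⟨ e₁ (d !) (badCount H d γ) b ⟩
          8 * (d ! * (badCount H d γ * b))  ≤⟨ *-monoʳ-≤ 8 (*-monoʳ-≤ (d !) (clear-bad ε a b (badCount H d γ) (n C d) εb≡a few)) ⟩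
          8 * (d ! * (a * (n C d)))         ≡⟨ e₂ (d !) a (n C d) ⟩
          8 * a * (d ! * (n C d))           ≤⟨ *-mono-≤ (*-monoˡ-≤ a 8≤2^k) (m!*nCm≤n^m n d) ⟩
          2 ^ k * a * n ^ d                 ≤⟨ <⇒≤ (descend (2 ^ k * a) b u n d r n>0 u≤n many) ⟩
          u ^ d * b                         ∎)
          where
          8≤2^k : 8 ≤ 2 ^ k
          8≤2^k = ^-monoʳ-≤ 2 {3} {k} (s≤s (≤-trans (s≤s (s≤s z≤n)) (m≤n+m r d₀)))
          e₁ : ∀ f x b → 8 * (f * x) * b ≡ 8 * (f * (x * b))
          e₁ = solve-∀
          e₂ : ∀ f a c → 8 * (f * (a * c)) ≡ 8 * a * (f * c)
          e₂ = solve-∀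
      decide : Dec (Done M) → Done M ⊎ ∃[ M′ ] Matching H M′ × length M < length M′
      decide (yes done) = inj₁ done
      decide (no ¬done) = inj₂ (augment H (lowDegree? H d γ)
        (λ S _ → large-degree H d γ r (k ^ suc r₀) Z t′ q g (m+n∸m≡n d r) Z≡ (s≤s z≤n) (sym Z≡) (subst (0 <_) t₀≡ (s≤s z≤n)) t′≡ g>0 γq≡g S)
        M matching
        (subst (size₁ ≤_) (sym length-leftover) (size₁≤u (≰⇒> ¬done)))
        (≤-trans (m≤n+m _ (b * size₁)) (<⇒≤ n-large))
        (subst₂ (λ x l → 8 * (d ! * x) ≤ l ^ d) (badCount≡ H d γ) (sym length-leftover) (few-bad (≰⇒> ¬done))))

  almost-perfect-matching : ∃ λ n₀ → (n : ℕ) → n₀ ≤ n → (H : KGraph n k)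
    → toℚ (badCount H d γ) ℚ.≤ ε ℚ.* toℚ (n C d)
    → Σ (List (Subset n)) λ M → IsMatching H M
    × (toℚ (n ∸ ∣ ⋃ M ∣) ^ℚ k ℚ.≤ (toℚ 2 ^ℚ k) ℚ.* ε ℚ.* (toℚ n ^ℚ k))
  -- `b * size₁` makes the uncovered set large enough, `k * suc size₂` the number of blocks, and
  -- `suc` keeps `n` positive.
  almost-perfect-matching = suc (b * size₁ + k * suc size₂) , large-matching

uniformity : ∀ k d₀ → suc d₀ ≤ k ∸ 2 → 3 ≤ k → ∃[ r₀ ] k ≡ suc d₀ + (2 + r₀)
uniformity (suc (suc k)) d₀ d≤ _ = k ∸ suc d₀ , trans (cong (2 +_) (sym (m+[n∸m]≡n d≤))) (shift (suc d₀) (k ∸ suc d₀))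
  where
  shift : ∀ x y → 2 + (x + y) ≡ x + (2 + y)
  shift = solve-∀

theorem2p12 : (k d : ℕ) → 3 ≤ k → 1 ≤ d → d ≤ k ∸ 2
    → (γ ε : ℚ) → 0ℚ ℚ.< γ → γ ℚ.< frac 1 4 → 0ℚ ℚ.< ε
    → ∃ λ n₀ → (n : ℕ) → n₀ ≤ n → (H : KGraph n k)
    → toℚ (badCount H d γ) ℚ.≤ ε ℚ.* toℚ (n C d)
    → Σ (List (Subset n)) λ M → IsMatching H M
    × (toℚ (n ∸ ∣ ⋃ M ∣) ^ℚ k ℚ.≤ (toℚ 2 ^ℚ k) ℚ.* ε ℚ.* (toℚ n ^ℚ k))
theorem2p12 k (suc d₀) 3≤k _ d≤k∸2 γ ε 0<γ _ 0<ε =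
  go (uniformity k d₀ d≤k∸2 3≤k) (positive-fraction γ 0<γ) (positive-fraction ε 0<ε)
  where
  go : ∃[ r₀ ] k ≡ suc d₀ + (2 + r₀) →
       ∃[ g ] ∃[ q ] 0 < g × 0 < q × γ ℚ.* toℚ q ≡ toℚ g →
       ∃[ a ] ∃[ b ] 0 < a × 0 < b × ε ℚ.* toℚ b ≡ toℚ a →
       ∃ λ n₀ → (n : ℕ) → n₀ ≤ n → (H : KGraph n k)
       → toℚ (badCount H (suc d₀) γ) ℚ.≤ ε ℚ.* toℚ (n C suc d₀)
       → Σ (List (Subset n)) λ M → IsMatching H M
       × (toℚ (n ∸ ∣ ⋃ M ∣) ^ℚ k ℚ.≤ (toℚ 2 ^ℚ k) ℚ.* ε ℚ.* (toℚ n ^ℚ k))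
  go (r₀ , refl) (g , q , g>0 , q>0 , γq≡g) (a , b , a>0 , b>0 , εb≡a) =
    LargeMatchings.almost-perfect-matching d₀ r₀ q g a b (parameters d₀ r₀ q q>0) γ ε g>0 γq≡g a>0 b>0 εb≡a
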